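{- Let $G$ be a $2$-connected graph which is $K_{1,3}$-free and $K_4$-minor-free. Then $G$ is outerplanar. Furthermore, $G$ is isomorphic to $\mathcal{Z}_d$ or $\mathcal{Z}^*_d$ for some $d\ge1$, or to a graph in $\mathcal{S}_t$ for some $t\ge3$.
   Context: All graphs are finite, simple and undirected. $G$ is $H$-free if it has no induced subgraph isomorphic to $H$; $H$-minor-free if it has no minor isomorphic to $H$. For $d\ge1$, $\mathcal{L}_d$ is the graph obtained from a path $v_0v_1\cdots v_{2d}$ by adding the edges $v_iv_{2d-i}$ for $i\in\{0,\dots,d-1\}$; $\mathcal{Z}_d$ is obtained from $\mathcal{L}_d$ by further adding the edges $v_iv_{2d-1-i}$ for $i\in\{0,\dots,d-2\}$; $\mathcal{Z}^*_d$ is $\mathcal{Z}_d$ with the vertex $v_d$ deleted. For $t\ge3$, $\mathcal{S}_t$ is the set of graphs obtained from a cycle $v_0v_1\cdots v_{t-1}v_0$ by choosing any subset $I\subseteq\{0,\dots,t-1\}$ and, for each $i\in I$, adding a new vertex $r_i$ adjacent exactly to $v_i$ and $v_{i+1}$ (indices modulo $t$). -}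

module Defs where

open import Data.Nat using (ℕ; zero; suc; _+_; _∸_; _≤_; _<_; _≡ᵇ_; _<ᵇ_)
open import Data.Bool using (Bool; true; false; _∨_; _∧_; if_then_else_)
open import Data.Bool.Properties using (∨-comm)
open import Data.Fin using (Fin; toℕ; splitAt; punchIn; _↑ˡ_; fromℕ)
open import Data.Fin.Properties using (_≟_; punchIn-injective)
open import Data.Maybe using (Maybe; just)
open import Data.Product using (Σ; ∃; _×_; _,_)
open import Data.Sum using (_⊎_; inj₁; inj₂)
open import Data.Unit using (⊤)
open import Relation.Nullary using (¬_; yes; no)
open import Relation.Binary.PropositionalEquality using (_≡_; _≢_; refl; sym)
open import Function.Definitions using (Injective; Bijective)

record Graph : Set where
  field
    n     : ℕ
    adj   : Fin n → Fin n → Bool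
    adjSym : ∀ u v → adj u v ≡ adj v u
    irref : ∀ u → adj u u ≡ false
open Graph public

closeAdj : {m : ℕ} → (Fin m → Fin m → Bool) → Fin m → Fin m → Bool
closeAdj raw u v with u ≟ v
... | yes _ = false
... | no  _ = raw u v ∨ raw v u

closeAdj-sym : {m : ℕ} (raw : Fin m → Fin m → Bool) → ∀ u v →
               closeAdj raw u v ≡ closeAdj raw v u
closeAdj-sym raw u v with u ≟ v | v ≟ u
... | yes _ | yes _ = refl
... | yes p | no q = Data.Empty.⊥-elim (q (sym p)) where import Data.Empty
... | no p | yes q = Data.Empty.⊥-elim (p (sym q)) where import Data.Empty
... | no _ | no _ = ∨-comm (raw u v) (raw v u)

closeAdj-irr : {m : ℕ} (raw : Fin m → Fin m → Bool) → ∀ u → closeAdj raw u u ≡ false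
closeAdj-irr raw u with u ≟ u
... | yes _ = refl
... | no p = Data.Empty.⊥-elim (p refl) where import Data.Empty

mkGraph : (m : ℕ) → (Fin m → Fin m → Bool) → Graph
mkGraph m raw = record { n = m ; adj = closeAdj raw
                       ; adjSym = closeAdj-sym raw ; irref = closeAdj-irr raw }

deleteVertex : (G : Graph) → {m : ℕ} → n G ≡ suc m → Fin (n G) → Graph
deleteVertex G {m} eq v = go (n G) (adj G) (adjSym G) (irref G) eq v
  where
  go : (k : ℕ) (a : Fin k → Fin k → Bool) → (∀ u w → a u w ≡ a w u) →
       (∀ u → a u u ≡ false) → k ≡ suc m → Fin k → Graph
  go .(suc m) a s i refl x = record
    { n = m ; adj = λ u w → a (punchIn x u) (punchIn x w)
    ; adjSym = λ u w → s (punchIn x u) (punchIn x w)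
    ; irref = λ u → i (punchIn x u) }

data PathIn (G : Graph) (P : Fin (n G) → Set) : Fin (n G) → Fin (n G) → Set where
  here : ∀ {u} → P u → PathIn G P u u
  step : ∀ {u v w} → P u → adj G u v ≡ true → PathIn G P v w → PathIn G P u w

Connected : Graph → Set
Connected G = ∀ u w → PathIn G (λ _ → ⊤) u w

TwoConnected : Graph → Set
TwoConnected G = (3 ≤ n G) × Connected G ×
  (∀ v u w → u ≢ v → w ≢ v → PathIn G (λ x → x ≢ v) u w)

InducedSub : Graph → Graph → Set
InducedSub H G = Σ (Fin (n H) → Fin (n G)) λ f →
  Injective _≡_ _≡_ f × (∀ i j → adj G (f i) (f j) ≡ adj H i j)

Free : Graph → Graph → Set
Free G H = ¬ InducedSub H G

-- H is a minor of G: a minor model given by disjoint, nonempty,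
-- connected branch sets (branch x ≡ just h  means x lies in the set of h),
-- with an edge of G between the branch sets of every edge of H.
Minor : Graph → Graph → Set
Minor H G = Σ (Fin (n G) → Maybe (Fin (n H))) λ branch →
  (∀ h → ∃ λ x → branch x ≡ just h) ×
  (∀ h x y → branch x ≡ just h → branch y ≡ just h →
       PathIn G (λ z → branch z ≡ just h) x y) ×
  (∀ h h' → adj H h h' ≡ true → Σ (Fin (n G)) λ x → Σ (Fin (n G)) λ y →
       branch x ≡ just h × branch y ≡ just h' × adj G x y ≡ true)

MinorFree : Graph → Graph → Set
MinorFree G H = ¬ Minor H G

_≅_ : Graph → Graph → Set
G ≅ H = Σ (Fin (n G) → Fin (n H)) λ f →
  Bijective _≡_ _≡_ f × (∀ u v → adj H (f u) (f v) ≡ adj G u v)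

-- Outerplanarity: the vertices can be placed in convex position on a
-- circle (cyclic order given by a permutation pos) such that no two
-- edges (drawn as chords) cross.

Outerplanar : Graph → Set
Outerplanar G = Σ (Fin (n G) → Fin (n G)) λ pos →
  Injective _≡_ _≡_ pos ×
  (∀ a b c d → adj G a b ≡ true → adj G c d ≡ true →
     ¬ (toℕ (pos a) < toℕ (pos c) × toℕ (pos c) < toℕ (pos b) ×
        toℕ (pos b) < toℕ (pos d)))

K4 : Graph
K4 = mkGraph 4 (λ _ _ → true)

K13 : Graph
K13 = mkGraph 4 (λ u _ → toℕ u ≡ᵇ 0)

rawL : ℕ → ℕ → ℕ → Bool
rawL d i j = (suc i ≡ᵇ j) ∨ ((i <ᵇ d) ∧ (j ≡ᵇ (d + d) ∸ i))

rawZ : ℕ → ℕ → ℕ → Bool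
rawZ d i j = rawL d i j ∨ ((suc i <ᵇ d) ∧ (j ≡ᵇ ((d + d) ∸ 1) ∸ i))

Zg : ℕ → Graph
Zg d = mkGraph (suc (d + d)) (λ u v → rawZ d (toℕ u) (toℕ v))

Zstar : ℕ → Graph
Zstar d = deleteVertex (Zg d) {d + d} refl (fromℕ d ↑ˡ d)

nextC : ℕ → ℕ → ℕ
nextC t i = if suc i ≡ᵇ t then 0 else suc i

-- Member of S_t: I is the image of an injective ρ : Fin k → Fin t.
-- Vertices: v_i = inject+ k i (i < t), r_{ρ j} = raise t j (j < k).
rawS : (t k : ℕ) → (Fin k → Fin t) → Fin (t + k) → Fin (t + k) → Bool
rawS t k ρ u v with splitAt t u | splitAt t v
... | inj₁ a | inj₁ b = nextC t (toℕ a) ≡ᵇ toℕ b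
... | inj₂ j | inj₁ b = (toℕ (ρ j) ≡ᵇ toℕ b) ∨ (nextC t (toℕ (ρ j)) ≡ᵇ toℕ b)
... | _ | _ = false

Sg : (t k : ℕ) → (Fin k → Fin t) → Graph
Sg t k ρ = mkGraph (t + k) (rawS t k ρ)

{-# OPTIONS --safe #-}
-- A longest cycle of G is Hamiltonian.  Otherwise some vertex z off the cycle
-- is adjacent to a vertex a on it and, by 2-connectivity, a path outside the
-- cycle joins z to another cycle vertex b.  If a and b are consecutive the path
-- can be inserted into the cycle; if not, claw-freeness at a lets z be inserted
-- next to a or joins the two cycle neighbours of a by a chord, which together
-- with the path from a to b gives a K₄ minor.
--
-- Two crossing chords of a Hamiltonian cycle also give a K₄ minor, whence
-- outerplanarity.  If some chord has at least three cycle edges on either side,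
-- claw-freeness forces a zigzag of triangles starting at an ear, so that, with
-- the cycle suitably numbered from 0 to N − 1, vertices i < j are adjacent iff
-- j = i + 1 or i + j ∈ {N − 1, N − 2}: this is Z_d or Z*_d according to the
-- parity of N.  If there is no such chord, every chord cuts off a single vertex,
-- and G is a cycle with triangles on its edges (or a small Z_d or Z*_d).
module Submission where

open import Defs
open import Data.Bool using (Bool; true; false; T; _∨_; _∧_)
open import Data.Bool.Properties using (¬-not; T-≡; T-∨; T-∧; ⇔→≡) renaming (_≟_ to _≟ᵇ_)
open import Data.Empty using (⊥; ⊥-elim)
open import Data.Fin using (Fin; zero; suc; toℕ; fromℕ; fromℕ<; punchIn; splitAt; join; _↑ˡ_)
open import Data.Fin.Properties using (toℕ-injective; any?; injective⇒≤)
import Data.Fin.Properties as Finₚ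
open import Data.List using (List; []; _∷_; _++_; length; lookup; applyUpTo; allFin; filter; initLast; _∷ʳ′_)
open import Data.List.Membership.Propositional using (_∈_; _∉_)
open import Data.List.Membership.Propositional.Properties using (∈-∃++; ∈-++⁺ˡ; ∈-++⁺ʳ; ∈-lookup; ∈-allFin; ∈-filter⁺; ∈-filter⁻)
open import Data.List.Properties using (length-++)
open import Data.List.Relation.Binary.Disjoint.Propositional using (Disjoint)
open import Data.List.Relation.Binary.Permutation.Propositional using (_↭_; ↭-refl; ↭-sym; ↭-trans; prep; ↭⇒↭ₛ)
open import Data.List.Relation.Binary.Permutation.Propositional.Properties using (++-comm; shift; ↭-length; ∈-resp-↭; ∷↭∷ʳ; ++⁺ˡ)
import Data.List.Relation.Binary.Permutation.Setoid.Properties as Permₛ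
open import Data.List.Relation.Unary.All using (All; []; _∷_)
import Data.List.Relation.Unary.All as All
import Data.List.Relation.Unary.All.Properties as Allₚ
open import Data.List.Relation.Unary.AllPairs as AllPairs using ([]; _∷_)
open import Data.List.Relation.Unary.Any using (here; there; index)
open import Data.List.Relation.Unary.Any.Properties using (lookup-index)
open import Data.List.Relation.Unary.Unique.Propositional using (Unique)
import Data.List.Relation.Unary.Unique.Propositional.Properties as Uniqueₚ
open import Data.Maybe using (Maybe; just; nothing)
open import Data.Nat using (ℕ; zero; suc; _+_; _*_; _∸_; _≤_; _<_; z≤n; s≤s; z<s; s<s; _≤?_; _<?_; _≡ᵇ_; _<ᵇ_)
open import Data.Nat.Properties using (<-cmp; ≤-refl; ≤-trans; n<1+n)
import Data.Nat.Properties as ℕₚ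
open import Data.Nat.Tactic.RingSolver using (solve-∀)
open import Data.Product using (Σ; ∃; ∃₂; _×_; _,_; proj₁; proj₂)
open import Data.Sum using (_⊎_; inj₁; inj₂; [_,_]′)
open import Data.Unit using (⊤)
open import Function using (_∘_; id)
open import Function.Bundles using (_⇔_; mk⇔; Equivalence)
open import Function.Definitions using (Injective)
open import Relation.Binary.Definitions using (tri<; tri≈; tri>)
open import Relation.Binary.PropositionalEquality using (_≡_; _≢_; refl; sym; trans; cong; cong₂; subst; subst₂; setoid; ≢-sym)
open import Relation.Nullary using (¬_; Dec; yes; no)
open import Relation.Nullary.Decidable using (_×-dec_)
open Equivalence using (to; from)

-- Lists without repetition

Unique-resp-↭ : {A : Set} {xs ys : List A} → xs ↭ ys → Unique xs → Unique ys
Unique-resp-↭ {A} p = Permₛ.Unique-resp-↭ (setoid A) (↭⇒↭ₛ p)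

Unique-++⁻-disjoint : {A : Set} (xs : List A) {ys : List A} → Unique (xs ++ ys) → Disjoint xs ys
Unique-++⁻-disjoint (x ∷ xs) (px ∷ _) (here refl , v∈ys) = All.lookup px (∈-++⁺ʳ xs v∈ys) refl
Unique-++⁻-disjoint (x ∷ xs) (_ ∷ u) (there v∈xs , v∈ys) = Unique-++⁻-disjoint xs u (v∈xs , v∈ys)

Unique-++⁻ʳ : {A : Set} (xs : List A) {ys : List A} → Unique (xs ++ ys) → Unique ys
Unique-++⁻ʳ [] u = u
Unique-++⁻ʳ (_ ∷ xs) (_ ∷ u) = Unique-++⁻ʳ xs u

lookup-injective : {A : Set} {xs : List A} → Unique xs → Injective _≡_ _≡_ (lookup xs)
lookup-injective (_ ∷ _) {zero} {zero} _ = refl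
lookup-injective (px ∷ _) {zero} {suc j} eq = ⊥-elim (All.lookup px (∈-lookup j) eq)
lookup-injective (px ∷ _) {suc i} {zero} eq = ⊥-elim (All.lookup px (∈-lookup i) (sym eq))
lookup-injective (_ ∷ u) {suc i} {suc j} eq = cong suc (lookup-injective u eq)

-- Claws and models of `K4` have four vertices; by symmetry it is enough to treat their six
-- increasing pairs, and the impossible ones are discharged here once.
Fin4-< : (P : Fin 4 → Fin 4 → Set) →
  P zero (suc zero) → P zero (suc (suc zero)) → P zero (suc (suc (suc zero))) →
  P (suc zero) (suc (suc zero)) → P (suc zero) (suc (suc (suc zero))) →
  P (suc (suc zero)) (suc (suc (suc zero))) →
  ∀ i j → toℕ i < toℕ j → P i j
Fin4-< P p01 p02 p03 p12 p13 p23 = λ where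
  zero (suc zero) _ → p01
  zero (suc (suc zero)) _ → p02
  zero (suc (suc (suc zero))) _ → p03
  (suc zero) (suc (suc zero)) _ → p12
  (suc zero) (suc (suc (suc zero))) _ → p13
  (suc (suc zero)) (suc (suc (suc zero))) _ → p23
  (suc _) (suc zero) (s<s ())
  (suc (suc _)) (suc (suc zero)) (s<s (s<s ()))
  (suc (suc (suc _))) (suc (suc (suc zero))) (s<s (s<s (s<s ())))

-- Indices modulo the length of a cycle

next : ∀ {P} → Fin (suc P) → Fin (suc P)
next {P} k with suc (toℕ k) <? suc P
... | yes l = fromℕ< l
... | no _ = zero

next-< : ∀ {P} (k : Fin (suc P)) → suc (toℕ k) < suc P → toℕ (next k) ≡ suc (toℕ k)
next-< {P} k l with suc (toℕ k) <? suc P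
... | yes l′ = Finₚ.toℕ-fromℕ< l′
... | no ¬l = ⊥-elim (¬l l)

next-last : ∀ {P} (k : Fin (suc P)) → toℕ k ≡ P → next k ≡ zero
next-last {P} k eq with suc (toℕ k) <? suc P
... | yes l = ⊥-elim (ℕₚ.<-irrefl (cong suc eq) l)
... | no _ = refl

-- Reduction modulo `suc P`, by iterating `next` instead of dividing: the cyclic successor of the
-- image of `i` is then the image of `suc i` by definition.
cyclicIndex : ∀ {P} → ℕ → Fin (suc P)
cyclicIndex zero = zero
cyclicIndex (suc i) = next (cyclicIndex i)

toℕ-cyclicIndex : ∀ {P} i → i < suc P → toℕ (cyclicIndex {P} i) ≡ i
toℕ-cyclicIndex zero _ = refl
toℕ-cyclicIndex {P} (suc i) l = trans (next-< (cyclicIndex i) (subst (λ t → suc t < suc P) (sym ih) l)) (cong suc ih)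
  where
  ih : toℕ (cyclicIndex {P} i) ≡ i
  ih = toℕ-cyclicIndex i (ℕₚ.<-trans (n<1+n i) l)

cyclicIndex-periodic : ∀ {P} i → cyclicIndex {P} (i + suc P) ≡ cyclicIndex i
cyclicIndex-periodic {P} zero = next-last (cyclicIndex P) (toℕ-cyclicIndex P (n<1+n P))
cyclicIndex-periodic (suc i) = cong next (cyclicIndex-periodic i)

-- Adjacency in Z_d and Z*_d by index sums

-- The chords of Z_d lie on two antidiagonals, of index sum 2d and 2d - 1. The bounds on `i` in
-- `rawZ` make its truncated subtractions exact.
rawZ-sound : ∀ d {i j} → rawZ d i j ≡ true → j ≡ suc i ⊎ i + j ≡ d + d ⊎ suc (i + j) ≡ d + d
rawZ-sound d {i} {j} eq with to T-∨ (from T-≡ eq)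
... | inj₁ L with to (T-∨ {suc i ≡ᵇ j}) L
...   | inj₁ s = inj₁ (sym (ℕₚ.≡ᵇ⇒≡ (suc i) j s))
...   | inj₂ t with to (T-∧ {i <ᵇ d}) t
...     | i<d , e = inj₂ (inj₁ (trans (cong (i +_) (ℕₚ.≡ᵇ⇒≡ j _ e))
                      (ℕₚ.m+[n∸m]≡n (≤-trans (ℕₚ.<⇒≤ (ℕₚ.<ᵇ⇒< i d i<d)) (ℕₚ.m≤m+n d d)))))
rawZ-sound d {i} {j} eq | inj₂ z with to (T-∧ {suc i <ᵇ d}) z
...   | i<d , e = inj₂ (inj₂ (trans (cong (λ x → suc (i + x)) (trans (ℕₚ.≡ᵇ⇒≡ j _ e) (ℕₚ.∸-+-assoc (d + d) 1 i)))
                    (ℕₚ.m+[n∸m]≡n (≤-trans (ℕₚ.<⇒≤ (ℕₚ.<ᵇ⇒< (suc i) d i<d)) (ℕₚ.m≤m+n d d)))))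

-- The bounds that `rawZ` asks for follow from `i < j`, because the smaller of two different
-- summands is less than half of the sum.
rawZ-complete : ∀ d {i j} → i < j → j ≡ suc i ⊎ i + j ≡ d + d ⊎ suc (i + j) ≡ d + d → rawZ d i j ≡ true
rawZ-complete d {i} {j} i<j h = to T-≡ (from T-∨ (lemma h))
  where
  half : ∀ {i j} → i < j → i + j ≤ d + d → i < d
  half {i} {j} i<j le = ℕₚ.≰⇒> λ d≤i → ℕₚ.<⇒≱ (ℕₚ.+-mono-≤-< d≤i (ℕₚ.≤-<-trans d≤i i<j)) le
  lemma : j ≡ suc i ⊎ i + j ≡ d + d ⊎ suc (i + j) ≡ d + d →
    T (rawL d i j) ⊎ T ((suc i <ᵇ d) ∧ (j ≡ᵇ ((d + d) ∸ 1) ∸ i))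
  lemma (inj₁ s) = inj₁ (from (T-∨ {suc i ≡ᵇ j}) (inj₁ (ℕₚ.≡⇒≡ᵇ (suc i) j (sym s))))
  lemma (inj₂ (inj₁ e)) = inj₁ (from (T-∨ {suc i ≡ᵇ j}) (inj₂ (from (T-∧ {i <ᵇ d})
    (ℕₚ.<⇒<ᵇ (half i<j (ℕₚ.≤-reflexive e)) , ℕₚ.≡⇒≡ᵇ j _ (trans (sym (ℕₚ.m+n∸m≡n i j)) (cong (_∸ i) e))))))
  lemma (inj₂ (inj₂ e)) with ℕₚ.m≤n⇒m<n∨m≡n i<j
  -- For `j ≡ suc i` the bound `suc i < d` fails, but the pair is an edge of the path.
  ... | inj₂ s = lemma (inj₁ (sym s))
  ... | inj₁ 1+i<j = inj₂ (from (T-∧ {suc i <ᵇ d})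
    (ℕₚ.<⇒<ᵇ (half 1+i<j (ℕₚ.≤-reflexive e)) ,
     ℕₚ.≡⇒≡ᵇ j _ (trans (sym (ℕₚ.m+n∸m≡n (suc i) j)) (trans (cong (_∸ suc i) e) (sym (ℕₚ.∸-+-assoc (d + d) 1 i))))))

closeAdj-≢ : ∀ {m} (raw : Fin m → Fin m → Bool) {u v} → u ≢ v → closeAdj raw u v ≡ raw u v ∨ raw v u
closeAdj-≢ raw {u} {v} u≢v with u Finₚ.≟ v
... | yes eq = ⊥-elim (u≢v eq)
... | no _ = refl

Zg-adj : ∀ d {u v : Fin (suc (d + d))} → toℕ u < toℕ v →
  adj (Zg d) u v ≡ true ⇔
  (toℕ v ≡ suc (toℕ u) ⊎ toℕ u + toℕ v ≡ d + d ⊎ suc (toℕ u + toℕ v) ≡ d + d)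
Zg-adj d {u} {v} u<v rewrite closeAdj-≢ (λ u v → rawZ d (toℕ u) (toℕ v)) {u} {v} (ℕₚ.<⇒≢ u<v ∘ cong toℕ) =
  mk⇔ sound (λ h → to T-≡ (from T-∨ (inj₁ (from T-≡ (rawZ-complete d u<v h)))))
  where
  sound : rawZ d (toℕ u) (toℕ v) ∨ rawZ d (toℕ v) (toℕ u) ≡ true →
    toℕ v ≡ suc (toℕ u) ⊎ toℕ u + toℕ v ≡ d + d ⊎ suc (toℕ u + toℕ v) ≡ d + d
  sound eq with to T-∨ (from T-≡ eq)
  ... | inj₁ t = rawZ-sound d (to T-≡ t)
  ... | inj₂ t with rawZ-sound d {toℕ v} {toℕ u} (to T-≡ t)
  ...   | inj₁ e = ⊥-elim (ℕₚ.<-asym u<v (subst (toℕ v <_) (sym e) (n<1+n _)))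
  ...   | inj₂ (inj₁ e) = inj₂ (inj₁ (trans (ℕₚ.+-comm (toℕ u) _) e))
  ...   | inj₂ (inj₂ e) = inj₂ (inj₂ (trans (cong suc (ℕₚ.+-comm (toℕ u) _)) e))

punchIn-< : ∀ {m} (x : Fin (suc m)) (u : Fin m) → toℕ u < toℕ x → toℕ (punchIn x u) ≡ toℕ u
punchIn-< (suc x) zero _ = refl
punchIn-< (suc x) (suc u) (s≤s l) = cong suc (punchIn-< x u l)

punchIn-≥ : ∀ {m} (x : Fin (suc m)) (u : Fin m) → toℕ x ≤ toℕ u → toℕ (punchIn x u) ≡ suc (toℕ u)
punchIn-≥ zero u _ = refl
punchIn-≥ (suc x) (suc u) (s≤s l) = cong suc (punchIn-≥ x u l)

-- Deleting v_d lowers every later index by one, so the two sums drop by one for a pair on different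
-- sides of v_d. On a common side neither sum can occur, before or after the renumbering.
Zstar-adj : ∀ d {u v : Fin (d + d)} → toℕ u < toℕ v →
  adj (Zstar d) u v ≡ true ⇔
  (toℕ v ≡ suc (toℕ u) ⊎ suc (toℕ u + toℕ v) ≡ d + d ⊎ suc (suc (toℕ u + toℕ v)) ≡ d + d)
Zstar-adj d {u} {v} u<v = cases (ℕₚ.<-≤-connex (toℕ u) d) (ℕₚ.<-≤-connex (toℕ v) d)
  where
  D : Fin (suc (d + d))
  D = fromℕ d ↑ˡ d
  toℕ-D : toℕ D ≡ d
  toℕ-D = trans (Finₚ.toℕ-↑ˡ (fromℕ d) d) (Finₚ.toℕ-fromℕ d)
  i j : ℕ
  i = toℕ u
  j = toℕ v
  R : Set
  R = j ≡ suc i ⊎ suc (i + j) ≡ d + d ⊎ suc (suc (i + j)) ≡ d + d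
  below : ∀ w → toℕ w < d → toℕ (punchIn D w) ≡ toℕ w
  below w l = punchIn-< D w (subst (toℕ w <_) (sym toℕ-D) l)
  above : ∀ w → d ≤ toℕ w → toℕ (punchIn D w) ≡ suc (toℕ w)
  above w l = punchIn-≥ D w (subst (_≤ toℕ w) (sym toℕ-D) l)
  result : ∀ {i′ j′} → toℕ (punchIn D u) ≡ i′ → toℕ (punchIn D v) ≡ j′ → i′ < j′ →
    (j′ ≡ suc i′ ⊎ i′ + j′ ≡ d + d ⊎ suc (i′ + j′) ≡ d + d → R) →
    (R → j′ ≡ suc i′ ⊎ i′ + j′ ≡ d + d ⊎ suc (i′ + j′) ≡ d + d) →
    adj (Zstar d) u v ≡ true ⇔ R
  result refl refl l f g = mk⇔ (f ∘ to (Zg-adj d l)) (from (Zg-adj d l) ∘ g)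
  cases : i < d ⊎ d ≤ i → j < d ⊎ d ≤ j → adj (Zstar d) u v ≡ true ⇔ R
  cases (inj₁ i<d) (inj₁ j<d) = result (below u i<d) (below v j<d) u<v
    (λ { (inj₁ e) → inj₁ e
       ; (inj₂ (inj₁ e)) → ⊥-elim (ℕₚ.<⇒≢ (ℕₚ.+-mono-< i<d j<d) e)
       ; (inj₂ (inj₂ e)) → inj₂ (inj₁ e) })
    (λ { (inj₁ e) → inj₁ e
       ; (inj₂ (inj₁ e)) → inj₂ (inj₂ e)
       ; (inj₂ (inj₂ e)) → ⊥-elim (ℕₚ.<⇒≢ small e) })
    where
    small : suc (suc (i + j)) < d + d
    small = subst (_≤ d + d) (cong suc (cong suc (ℕₚ.+-suc i j))) (ℕₚ.+-mono-≤ (≤-trans (s≤s u<v) j<d) j<d)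
  cases (inj₁ i<d) (inj₂ d≤j) = result (below u i<d) (above v d≤j) (ℕₚ.m<n⇒m<1+n u<v)
    (λ { (inj₁ e) → ⊥-elim (ℕₚ.<⇒≢ u<v (sym (ℕₚ.suc-injective e)))
       ; (inj₂ (inj₁ e)) → inj₂ (inj₁ (trans (sym (ℕₚ.+-suc i j)) e))
       ; (inj₂ (inj₂ e)) → inj₂ (inj₂ (trans (cong suc (sym (ℕₚ.+-suc i j))) e)) })
    (λ { (inj₁ e) → inj₂ (inj₁ (middle e))
       ; (inj₂ (inj₁ e)) → inj₂ (inj₁ (trans (ℕₚ.+-suc i j) e))
       ; (inj₂ (inj₂ e)) → inj₂ (inj₂ (trans (cong suc (ℕₚ.+-suc i j)) e)) })
    where
    -- The only newly consecutive pair comes from v_{d-1} and v_{d+1}, which are joined by a chord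
    -- of sum 2d.
    middle : j ≡ suc i → i + suc j ≡ d + d
    middle e = trans (ℕₚ.+-suc i j) (cong₂ _+_ 1+i≡d (trans e 1+i≡d))
      where
      1+i≡d : suc i ≡ d
      1+i≡d = ℕₚ.≤-antisym i<d (subst (d ≤_) e d≤j)
  cases (inj₂ d≤i) (inj₁ j<d) = ⊥-elim (ℕₚ.<-asym u<v (ℕₚ.<-≤-trans j<d d≤i))
  cases (inj₂ d≤i) (inj₂ d≤j) = result (above u d≤i) (above v d≤j) (s≤s u<v)
    (λ { (inj₁ e) → inj₁ (ℕₚ.suc-injective e)
       ; (inj₂ (inj₁ e)) → ⊥-elim (ℕₚ.<⇒≢ (ℕₚ.+-mono-≤-< (ℕₚ.m≤n⇒m≤1+n d≤i) (s≤s d≤j)) (sym e))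
       ; (inj₂ (inj₂ e)) → ⊥-elim (ℕₚ.<⇒≢ (ℕₚ.m<n⇒m<1+n (ℕₚ.+-mono-≤-< (ℕₚ.m≤n⇒m≤1+n d≤i) (s≤s d≤j))) (sym e)) })
    (λ { (inj₁ e) → inj₁ (cong suc e)
       ; (inj₂ (inj₁ e)) → ⊥-elim (ℕₚ.<⇒≢ (s≤s (ℕₚ.+-mono-≤ d≤i d≤j)) (sym e))
       ; (inj₂ (inj₂ e)) → ⊥-elim (ℕₚ.<⇒≢ (ℕₚ.m<n⇒m<1+n (s≤s (ℕₚ.+-mono-≤ d≤i d≤j))) (sym e)) })

-- Adjacency in the graphs of S_t

closeAdj-⇔ : ∀ {m} (raw : Fin m → Fin m → Bool) {u v} →
  closeAdj raw u v ≡ true ⇔ (u ≢ v × (raw u v ≡ true ⊎ raw v u ≡ true))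
closeAdj-⇔ raw {u} {v} with u Finₚ.≟ v
... | yes eq = mk⇔ (λ ()) (λ (u≢v , _) → ⊥-elim (u≢v eq))
... | no u≢v = mk⇔ (λ eq → u≢v , ∨-split (to T-∨ (from T-≡ eq)))
                   (λ (_ , h) → to T-≡ (from T-∨ (∨-merge h)))
  where
  ∨-split : T (raw u v) ⊎ T (raw v u) → raw u v ≡ true ⊎ raw v u ≡ true
  ∨-split = [ inj₁ ∘ to T-≡ , inj₂ ∘ to T-≡ ]′
  ∨-merge : raw u v ≡ true ⊎ raw v u ≡ true → T (raw u v) ⊎ T (raw v u)
  ∨-merge = [ inj₁ ∘ from T-≡ , inj₂ ∘ from T-≡ ]′

nextC-last : ∀ {t i} → suc i ≡ t → nextC t i ≡ 0
nextC-last {i = i} refl rewrite to T-≡ (ℕₚ.≡⇒≡ᵇ (suc i) (suc i) refl) = refl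

nextC-suc : ∀ {t i} → suc i ≢ t → nextC t i ≡ suc i
nextC-suc {t} {i} ne with suc i ≡ᵇ t in eq
... | true = ⊥-elim (ne (ℕₚ.≡ᵇ⇒≡ (suc i) t (from T-≡ eq)))
... | false = refl

-- The one-sided relation `rawS` on vertices already split into inner vertices and tips, so that
-- later case analyses meet no Boolean tests.
Arc : (t k : ℕ) → (Fin k → Fin t) → Fin t ⊎ Fin k → Fin t ⊎ Fin k → Set
Arc t k ρ (inj₁ a) (inj₁ b) = nextC t (toℕ a) ≡ toℕ b
Arc t k ρ (inj₂ j) (inj₁ b) = ρ j ≡ b ⊎ nextC t (toℕ (ρ j)) ≡ toℕ b
Arc t k ρ _ (inj₂ _) = ⊥

rawS-⇔ : ∀ t k ρ (u v : Fin (t + k)) →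
  rawS t k ρ u v ≡ true ⇔ Arc t k ρ (splitAt t u) (splitAt t v)
rawS-⇔ t k ρ u v with splitAt t u | splitAt t v
... | inj₁ a | inj₁ b = mk⇔ (λ eq → ℕₚ.≡ᵇ⇒≡ _ _ (from T-≡ eq)) (λ eq → to T-≡ (ℕₚ.≡⇒≡ᵇ _ _ eq))
... | inj₁ _ | inj₂ _ = mk⇔ (λ ()) (λ ())
... | inj₂ _ | inj₂ _ = mk⇔ (λ ()) (λ ())
... | inj₂ j | inj₁ b = mk⇔
  (λ eq → [ inj₁ ∘ toℕ-injective ∘ ℕₚ.≡ᵇ⇒≡ _ _ , inj₂ ∘ ℕₚ.≡ᵇ⇒≡ _ _ ]′ (to (T-∨ {toℕ (ρ j) ≡ᵇ toℕ b}) (from T-≡ eq)))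
  (λ h → to T-≡ (from (T-∨ {toℕ (ρ j) ≡ᵇ toℕ b})
    ([ inj₁ ∘ ℕₚ.≡⇒≡ᵇ _ _ ∘ cong toℕ , inj₂ ∘ ℕₚ.≡⇒≡ᵇ _ _ ]′ h)))

-- Edges, claw-freeness and walks

module InGraph (G : Graph) where

  V : Set
  V = Fin (n G)

  E : V → V → Set
  E u v = adj G u v ≡ true

  E-sym : ∀ {u v} → E u v → E v u
  E-sym {u} {v} e = trans (adjSym G v u) e

  E-irrefl : ∀ {u v} → E u v → u ≢ v
  E-irrefl {u} e refl with trans (sym e) (irref G u)
  ... | ()

  E? : ∀ u v → Dec (E u v)
  E? u v = adj G u v ≟ᵇ true

  open import Data.List.Membership.DecPropositional (Finₚ._≟_ {n G}) using (_∈?_)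

  preserves-adj : (H : Graph) (f : Fin (n H) → V) →
    (∀ i j → toℕ i < toℕ j → adj G (f i) (f j) ≡ adj H i j) →
    ∀ i j → adj G (f i) (f j) ≡ adj H i j
  preserves-adj H f h i j with <-cmp (toℕ i) (toℕ j)
  ... | tri< i<j _ _ = h i j i<j
  ... | tri> _ _ j<i = trans (adjSym G (f i) (f j)) (trans (h j i j<i) (adjSym H j i))
  ... | tri≈ _ i≡j _ rewrite toℕ-injective i≡j = trans (irref G (f j)) (sym (irref H j))

  injective-from-< : ∀ {m} (f : Fin m → V) → (∀ i j → toℕ i < toℕ j → f i ≢ f j) →
    Injective _≡_ _≡_ f
  injective-from-< f h {i} {j} eq with <-cmp (toℕ i) (toℕ j)
  ... | tri< i<j _ _ = ⊥-elim (h i j i<j eq)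
  ... | tri> _ _ j<i = ⊥-elim (h j i j<i (sym eq))
  ... | tri≈ _ i≡j _ = toℕ-injective i≡j

  ClawFree : Set
  ClawFree = ∀ {x a b c} → a ≢ b → a ≢ c → b ≢ c → E x a → E x b → E x c →
    E a b ⊎ E a c ⊎ E b c

  -- Adjacency is decidable, so the exclusion of induced claws turns into a choice of an edge among
  -- three neighbours.
  clawFree : Free G K13 → ClawFree
  clawFree free {x} {a} {b} {c} a≢b a≢c b≢c xa xb xc
    with E? a b | E? a c | E? b c
  ... | yes ab | _ | _ = inj₁ ab
  ... | no _ | yes ac | _ = inj₂ (inj₁ ac)
  ... | no _ | no _ | yes bc = inj₂ (inj₂ bc)
  ... | no ab | no ac | no bc = ⊥-elim (free (f , injective-from-< f distinct , preserves-adj K13 f adjs))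
    where
    f : Fin 4 → V
    f = lookup (x ∷ a ∷ b ∷ c ∷ [])
    distinct : ∀ i j → toℕ i < toℕ j → f i ≢ f j
    distinct = Fin4-< _ (E-irrefl xa) (E-irrefl xb) (E-irrefl xc) a≢b a≢c b≢c
    adjs : ∀ i j → toℕ i < toℕ j → adj G (f i) (f j) ≡ adj K13 i j
    adjs = Fin4-< _ xa xb xc (¬-not ab) (¬-not ac) (¬-not bc)

  -- Walk u xs v: the vertices u ∷ xs form a walk ending in v.
  data Walk : V → List V → V → Set where
    []  : ∀ {u} → Walk u [] u
    _∷_ : ∀ {u v w xs} → E u v → Walk v xs w → Walk u (v ∷ xs) w

  last∈ : ∀ {u xs v} → Walk u xs v → v ∈ u ∷ xs
  last∈ [] = here refl
  last∈ (_ ∷ w) = there (last∈ w)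

  walk-++ : ∀ {u xs v w ys z} → Walk u xs v → E v w → Walk w ys z → Walk u (xs ++ w ∷ ys) z
  walk-++ [] e q = e ∷ q
  walk-++ (e′ ∷ p) e q = e′ ∷ walk-++ p e q

  walk-split : ∀ {u} xs {y ys w} → Walk u (xs ++ y ∷ ys) w →
    ∃ λ v → Walk u xs v × E v y × Walk y ys w
  walk-split [] (e ∷ p) = _ , [] , e , p
  walk-split (x ∷ xs) (e ∷ p) with walk-split xs p
  ... | v , q , e′ , r = v , e ∷ q , e′ , r

  walk-reverse : ∀ {u xs v} → Walk u xs v → ∃ λ ys → Walk v ys u × (v ∷ ys) ↭ (u ∷ xs)
  walk-reverse [] = [] , [] , ↭-refl
  walk-reverse {u} (e ∷ p) with walk-reverse p
  ... | ys , q , r = ys ++ u ∷ [] , walk-++ q (E-sym e) [] ,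
                     ↭-trans (↭-sym (∷↭∷ʳ u (_ ∷ ys))) (prep u r)

  -- Serves to cut loops out of a walk while keeping what is known about its vertices.
  walk-suffix : ∀ {v xs w u} → Walk v xs w → u ∈ v ∷ xs →
    ∃ λ ys → Walk u ys w × (Unique (v ∷ xs) → Unique (u ∷ ys)) × (∀ {P : V → Set} → All P (v ∷ xs) → All P (u ∷ ys))
  walk-suffix p (here refl) = _ , p , id , id
  walk-suffix (_ ∷ p) (there u∈) with walk-suffix p u∈
  ... | ys , q , f , g = ys , q , (λ { (_ ∷ uq) → f uq }) , λ { (_ ∷ a) → g a }

  walk-path : ∀ {P : V → Set} {u xs v} → Walk u xs v → All P (u ∷ xs) →
    ∀ {y} → y ∈ u ∷ xs → PathIn G P u y
  walk-path _ (pu ∷ _) (here refl) = here pu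
  walk-path (e ∷ p) (pu ∷ a) (there y∈) = step pu e (walk-path p a y∈)

  path-trans : ∀ {P u v w} → PathIn G P u v → PathIn G P v w → PathIn G P u w
  path-trans (here _) q = q
  path-trans (step pu e p) q = step pu e (path-trans p q)

  path-start : ∀ {P u v} → PathIn G P u v → P u
  path-start (here pu) = pu
  path-start (step pu _ _) = pu

  path-sym : ∀ {P u v} → PathIn G P u v → PathIn G P v u
  path-sym (here pu) = here pu
  path-sym (step pu e p) = path-trans (path-sym p) (step (path-start p) (E-sym e) (here pu))

  -- Minors from disjoint paths

  Touch : List V → List V → Set
  Touch xs ys = ∃₂ λ x y → x ∈ xs × y ∈ ys × E x y

  Touch-sym : ∀ {xs ys} → Touch xs ys → Touch ys xs
  Touch-sym (x , y , x∈ , y∈ , e) = y , x , y∈ , x∈ , E-sym e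

  record IsPath (xs : List V) : Set where
    constructor isPath
    field
      {first final} : V
      {rest} : List V
      isCons : xs ≡ first ∷ rest
      walk   : Walk first rest final

  -- Each branch set is the vertex list of a walk, hence connected. The single `Unique` hypothesis
  -- gives all pairwise disjointness, so a vertex lies in at most one list and `branch` is well
  -- determined.
  K4-minor : (B : Fin 4 → List V) → (∀ h → IsPath (B h)) →
    Unique (B zero ++ B (suc zero) ++ B (suc (suc zero)) ++ B (suc (suc (suc zero)))) →
    (∀ h h′ → toℕ h < toℕ h′ → Touch (B h) (B h′)) →
    Minor K4 G
  K4-minor B paths uniq touch = branch , nonempty , connected , edges
    where
    B₁ B₂ B₃ : List V
    B₁ = B (suc zero)
    B₂ = B (suc (suc zero))
    B₃ = B (suc (suc (suc zero)))
    u₁ : Unique (B₁ ++ B₂ ++ B₃)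
    u₁ = Unique-++⁻ʳ (B zero) uniq
    u₂ : Unique (B₂ ++ B₃)
    u₂ = Unique-++⁻ʳ B₁ u₁

    disjoint : ∀ h h′ → toℕ h < toℕ h′ → Disjoint (B h) (B h′)
    disjoint = Fin4-< _
      (λ (a , b) → Unique-++⁻-disjoint (B zero) uniq (a , ∈-++⁺ˡ b))
      (λ (a , b) → Unique-++⁻-disjoint (B zero) uniq (a , ∈-++⁺ʳ B₁ (∈-++⁺ˡ b)))
      (λ (a , b) → Unique-++⁻-disjoint (B zero) uniq (a , ∈-++⁺ʳ B₁ (∈-++⁺ʳ B₂ b)))
      (λ (a , b) → Unique-++⁻-disjoint B₁ u₁ (a , ∈-++⁺ˡ b))
      (λ (a , b) → Unique-++⁻-disjoint B₁ u₁ (a , ∈-++⁺ʳ B₂ b))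
      (Unique-++⁻-disjoint B₂ u₂)

    same : ∀ {x} h h′ → x ∈ B h → x ∈ B h′ → h ≡ h′
    same h h′ a b with <-cmp (toℕ h) (toℕ h′)
    ... | tri< l _ _ = ⊥-elim (disjoint h h′ l (a , b))
    ... | tri≈ _ eq _ = toℕ-injective eq
    ... | tri> _ _ l = ⊥-elim (disjoint h′ h l (b , a))

    branch : V → Maybe (Fin 4)
    branch x with any? (λ h → x ∈? B h)
    ... | yes (h , _) = just h
    ... | no _ = nothing

    branch⁺ : ∀ {h x} → x ∈ B h → branch x ≡ just h
    branch⁺ {h} {x} x∈ with any? (λ h → x ∈? B h)
    ... | yes (h′ , x∈′) = cong just (same h′ h x∈′ x∈)
    ... | no ∄ = ⊥-elim (∄ (h , x∈))

    branch⁻ : ∀ {h x} → branch x ≡ just h → x ∈ B h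
    branch⁻ {h} {x} eq with any? (λ h → x ∈? B h)
    branch⁻ refl | yes (h , x∈) = x∈

    nonempty : ∀ h → ∃ λ x → branch x ≡ just h
    nonempty h with B h | paths h | branch⁺ {h}
    ... | _ | isPath refl _ | br = _ , br (here refl)

    connected : ∀ h x y → branch x ≡ just h → branch y ≡ just h →
      PathIn G (λ z → branch z ≡ just h) x y
    connected h x y bx by with B h | paths h | branch⁻ {h} {x} bx | branch⁻ {h} {y} by | All.tabulate (branch⁺ {h})
    ... | _ | isPath refl w | x∈ | y∈ | all = path-trans (path-sym (walk-path w all x∈)) (walk-path w all y∈)

    edges : ∀ h h′ → adj K4 h h′ ≡ true → Σ V λ x → Σ V λ y →
      branch x ≡ just h × branch y ≡ just h′ × adj G x y ≡ true
    edges h h′ e with <-cmp (toℕ h) (toℕ h′)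
    edges h h′ e | tri< l _ _ with touch h h′ l
    ... | x , y , x∈ , y∈ , xy = x , y , branch⁺ x∈ , branch⁺ y∈ , xy
    edges h h′ e | tri> _ _ l with touch h′ h l
    ... | x , y , x∈ , y∈ , xy = y , x , branch⁺ y∈ , branch⁺ x∈ , E-sym xy
    edges h h′ e | tri≈ _ eq _ with toℕ-injective eq
    edges h h e | tri≈ _ eq _ | refl with trans (sym e) (irref K4 h)
    ... | ()

  -- The branch sets are the paths a ∷ as, …, d ∷ ds.
  cross-minor : ∀ {a as a′ b bs b′ c cs c′ d ds d′} →
    Walk a as a′ → Walk b bs b′ → Walk c cs c′ → Walk d ds d′ →
    Unique ((a ∷ as) ++ (b ∷ bs) ++ (c ∷ cs) ++ (d ∷ ds)) →
    Touch (a ∷ as) (b ∷ bs) → Touch (b ∷ bs) (c ∷ cs) →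
    Touch (c ∷ cs) (d ∷ ds) → Touch (d ∷ ds) (a ∷ as) →
    Touch (a ∷ as) (c ∷ cs) → Touch (b ∷ bs) (d ∷ ds) →
    Minor K4 G
  cross-minor {a} {as} {_} {b} {bs} {_} {c} {cs} {_} {d} {ds} wa wb wc wd uniq ab bc cd da ac bd =
    K4-minor B paths uniq touch
    where
    B : Fin 4 → List V
    B = lookup ((a ∷ as) ∷ (b ∷ bs) ∷ (c ∷ cs) ∷ (d ∷ ds) ∷ [])
    paths : ∀ h → IsPath (B h)
    paths zero = isPath refl wa
    paths (suc zero) = isPath refl wb
    paths (suc (suc zero)) = isPath refl wc
    paths (suc (suc (suc zero))) = isPath refl wd
    touch : ∀ h h′ → toℕ h < toℕ h′ → Touch (B h) (B h′)
    touch = Fin4-< _ ab ac (Touch-sym {d ∷ ds} {a ∷ as} da) bc bd cd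

  -- Hamiltonicity

  -- An edge traversed back and forth counts as a cycle with two vertices; a lone vertex does not,
  -- as its closing edge would be a loop.
  record Cycle (u : V) (xs : List V) : Set where
    constructor cycle
    field
      {final} : V
      walk    : Walk u xs final
      closing : E final u
      unique  : Unique (u ∷ xs)

  rotateTo : ∀ {u xs x} → Cycle u xs → x ∈ u ∷ xs →
    ∃ λ ys → Cycle x ys × (x ∷ ys) ↭ (u ∷ xs)
  rotateTo C (here refl) = _ , C , ↭-refl
  rotateTo {u} {xs} {x} (cycle w c uq) (there x∈) with ∈-∃++ x∈
  ... | l , r , refl with walk-split l w
  ... | v , p , e , q = r ++ u ∷ l , cycle (walk-++ q c p) e (Unique-resp-↭ (↭-sym perm) uq) , perm
    where
    perm : (x ∷ r ++ u ∷ l) ↭ (u ∷ l ++ x ∷ r)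
    perm = ++-comm (x ∷ r) (u ∷ l)

  -- The part of a walk up to its first entry into `S`, with loops removed. The predicate `P`
  -- retains what the walk avoids; it is needed at `target`, to make it differ from a given vertex.
  record Exit (P : V → Set) (S : List V) (u : V) : Set where
    field
      {rest} : List V
      {final target} : V
      walk    : Walk u rest final
      outside : All (_∉ S) (u ∷ rest)
      unique  : Unique (u ∷ rest)
      edge    : E final target
      target∈ : target ∈ S
      holds   : P target

  exit : ∀ {P S u w} → PathIn G P u w → u ∉ S → w ∈ S → Exit P S u
  exit (here _) u∉ w∈ = ⊥-elim (u∉ w∈)
  exit {P} {S} {u} (step {v = v} pu e p) u∉ w∈ with v ∈? S
  ... | yes v∈ = record { walk = [] ; outside = u∉ ∷ [] ; unique = [] ∷ [] ; edge = e
                        ; target∈ = v∈ ; holds = path-start p }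
  ... | no v∉ with exit p v∉ w∈
  ... | record { rest = rest ; walk = q ; outside = out ; unique = uq ; edge = f ; target∈ = t∈ ; holds = pt }
    with u ∈? (v ∷ rest)
  ... | no u∉q = record { walk = e ∷ q ; outside = u∉ ∷ out ; unique = Allₚ.¬Any⇒All¬ _ u∉q ∷ uq
                        ; edge = f ; target∈ = t∈ ; holds = pt }
  -- The path found from `v` comes back through `u`; its part from `u` on is kept.
  ... | yes u∈q with walk-suffix q u∈q
  ... | ys , r , keepUnique , keepAll = record
    { walk = r ; outside = keepAll out ; unique = keepUnique uq ; edge = f ; target∈ = t∈ ; holds = pt }

  Longer : V → List V → Set
  Longer u xs = ∃₂ λ v ys → Cycle v ys × length xs < length ys

  extend-at : ClawFree → MinorFree G K4 → ∀ {a M z} → Cycle a M →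
    E z a → Exit (_≢ a) (a ∷ M) z → Longer a M
  extend-at _ _ _ _ record { target∈ = here b≡a ; holds = b≢a } = ⊥-elim (b≢a b≡a)
  extend-at claw free {a} {z = z} (cycle wM closing uniqM) za
    record { rest = Q ; final = y ; target = b ; walk = wQ ; outside = out ; unique = uniqQ ; edge = yb
           ; target∈ = there b∈M } with ∈-∃++ b∈M
  ... | M₁ , M₂ , refl = go M₁ M₂ wM closing uniqM uniqQM (Allₚ.¬Any⇒All¬ _ (All.head out) ∷ uniqM)
    where
    uniqQM : Unique ((z ∷ Q) ++ (a ∷ M₁ ++ b ∷ M₂))
    uniqQM = Uniqueₚ.++⁺ uniqQ uniqM (λ (p , q) → All.lookup out p q)

    go : ∀ M₁ M₂ {v} → Walk a (M₁ ++ b ∷ M₂) v → E v a → Unique (a ∷ M₁ ++ b ∷ M₂) →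
      Unique ((z ∷ Q) ++ (a ∷ M₁ ++ b ∷ M₂)) → Unique (z ∷ a ∷ M₁ ++ b ∷ M₂) →
      Longer a (M₁ ++ b ∷ M₂)
    -- `b` follows `a` on the cycle: the outer path replaces the edge between them.
    go [] M₂ (_ ∷ w) c uq uqQ _ =
      a , (z ∷ Q) ++ b ∷ M₂ , cycle (E-sym za ∷ walk-++ wQ yb w) c (Unique-resp-↭ (shift a (z ∷ Q) (b ∷ M₂)) uqQ) ,
      s≤s (subst (length (b ∷ M₂) ≤_) (sym (length-++ Q)) (ℕₚ.m≤n+m _ (length Q)))
    go (p ∷ M₁) M₂ w c uq uqQ uqz with initLast M₂
    -- `b` precedes `a` on the cycle: the outer path is inserted backwards, from `b` to `a`.
    ... | [] with walk-split (p ∷ M₁) w | walk-reverse wQ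
    ... | x , w₁ , e , [] | R , wR , perm =
      a , (p ∷ M₁ ++ b ∷ []) ++ y ∷ R , cycle (walk-++ w (E-sym yb) wR) za
        (Unique-resp-↭ (↭-trans (++-comm (z ∷ Q) (a ∷ p ∷ M₁ ++ b ∷ [])) (++⁺ˡ (a ∷ p ∷ M₁ ++ b ∷ []) (↭-sym perm))) uqQ) ,
      subst (length (p ∷ M₁ ++ b ∷ []) <_) (sym (length-++ (p ∷ M₁ ++ b ∷ []))) (ℕₚ.m<m+n _ z<s)
    go (p ∷ M₁) .(M₂ ++ q ∷ []) w@(ap ∷ w′) c uq uqQ uqz | M₂ ∷ʳ′ q with walk-split M₁ w′
    ... | p′ , w₁ , p′b , w₂ with walk-split M₂ w₂
    ... | q′ , w₃ , q′q , [] with E? z p | E? z q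
    ... | yes zp | _ = a , z ∷ p ∷ M₁ ++ b ∷ M₂ ++ q ∷ [] ,
      cycle (E-sym za ∷ zp ∷ w′) c (Unique-resp-↭ (shift a (z ∷ []) _) uqz) , n<1+n _
    ... | no _ | yes zq = a , (p ∷ M₁ ++ b ∷ M₂ ++ q ∷ []) ++ z ∷ [] ,
      cycle (walk-++ w (E-sym zq) []) za (Unique-resp-↭ (∷↭∷ʳ z _) uqz) ,
      subst (length (p ∷ M₁ ++ b ∷ M₂ ++ q ∷ []) <_) (sym (length-++ (p ∷ M₁ ++ b ∷ M₂ ++ q ∷ []))) (ℕₚ.m<m+n _ z<s)
    -- The branch sets are `a` with the outer path, the arc from `p` to just before `b`, the arc
    -- from `b` to just before `q`, and `q`. The first and third touch through the outer path, the
    -- second and fourth through the chord `pq`.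
    ... | no ¬zp | no ¬zq = ⊥-elim (free (cross-minor (E-sym za ∷ wQ) w₁ w₃ ([] {q})
            (Unique-resp-↭ (shift a (z ∷ Q) _) uqQ)
            (a , p , here refl , here refl , ap)
            (p′ , b , last∈ w₁ , here refl , p′b)
            (q′ , q , last∈ w₃ , here refl , q′q)
            (q , a , here refl , here refl , c)
            (y , b , there (last∈ wQ) , here refl , yb)
            (p , q , here refl , here refl , pq)))
      where
      q∈ : q ∈ M₁ ++ b ∷ M₂ ++ q ∷ []
      q∈ = ∈-++⁺ʳ M₁ (there (∈-++⁺ʳ M₂ (here refl)))
      p≢q : p ≢ q
      p≢q = All.lookup (AllPairs.head (AllPairs.tail uq)) q∈
      z≢ : ∀ {s} → s ∈ p ∷ M₁ ++ b ∷ M₂ ++ q ∷ [] → z ≢ s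
      z≢ s∈ = All.lookup (AllPairs.head uqz) (there s∈)
      pq : E p q
      pq with claw p≢q (≢-sym (z≢ (here refl))) (≢-sym (z≢ (there q∈))) ap (E-sym c) (E-sym za)
      ... | inj₁ e = e
      ... | inj₂ (inj₁ e) = ⊥-elim (¬zp (E-sym e))
      ... | inj₂ (inj₂ e) = ⊥-elim (¬zq (E-sym e))

  -- Connectedness gives an edge from some `z` off the cycle to some `a` on it. After rotating the
  -- cycle to start at `a`, a walk from `z` to the next cycle vertex that avoids `a` supplies the
  -- second contact.
  extend : TwoConnected G → ClawFree → MinorFree G K4 → ∀ {u xs x} → Cycle u xs →
    x ∉ u ∷ xs → Longer u xs
  extend (_ , conn , conn-) claw free {u} {xs} {x} C x∉ = go (exit (conn x u) x∉ (here refl))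
    where
    go : Exit (λ _ → ⊤) (u ∷ xs) x → Longer u xs
    go ex with rotateTo C (Exit.target∈ ex)
    ... | [] , cycle [] c _ , _ = ⊥-elim (E-irrefl c refl)
    ... | m ∷ M , C′ , perm with extend-at claw free C′ (Exit.edge ex)
                           (exit (conn- a z m z≢a m≢a) (z∉ ∘ ∈-resp-↭ perm) (there (here refl)))
      where
      a z : V
      a = Exit.target ex
      z = Exit.final ex
      z∉ : z ∉ u ∷ xs
      z∉ = All.lookup (Exit.outside ex) (last∈ (Exit.walk ex))
      z≢a : z ≢ a
      z≢a = E-irrefl (Exit.edge ex)
      m≢a : m ≢ a
      m≢a m≡a with Cycle.unique C′
      ... | (a≢m ∷ _) ∷ _ = a≢m (sym m≡a)
    ... | v , ys , C″ , l = v , ys , C″ , subst (_< length ys) (ℕₚ.suc-injective (↭-length perm)) l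

  -- An edge, viewed as a cycle with two vertices, is enough to start the extension process.
  initialCycle : TwoConnected G → ∃₂ Cycle
  initialCycle (3≤n , conn , _) = fromPath (conn v₀ v₁) v₀≢v₁
    where
    fromPath : ∀ {u w} → PathIn G (λ _ → ⊤) u w → u ≢ w → ∃₂ Cycle
    fromPath (here _) u≢u = ⊥-elim (u≢u refl)
    fromPath (step {u} {v} _ e _) _ = u , v ∷ [] , cycle (e ∷ []) (E-sym e) ((E-irrefl e ∷ []) ∷ [] ∷ [])
    v₀ v₁ : V
    v₀ = fromℕ< (≤-trans (s≤s z≤n) 3≤n)
    v₁ = fromℕ< (≤-trans (s≤s (s≤s z≤n)) 3≤n)
    v₀≢v₁ : v₀ ≢ v₁
    v₀≢v₁ eq with trans (sym (Finₚ.toℕ-fromℕ< _)) (trans (cong toℕ eq) (Finₚ.toℕ-fromℕ< _))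
    ... | ()

  unique-length : ∀ {xs : List V} → Unique xs → length xs ≤ n G
  unique-length uq = injective⇒≤ (lookup-injective uq)

  -- Each extension consumes one unit of fuel. At fuel zero the `suc (length xs)` distinct vertices
  -- of the cycle would outnumber the graph.
  hamiltonian : TwoConnected G → ClawFree → MinorFree G K4 →
    ∃₂ λ u xs → Cycle u xs × (∀ v → v ∈ u ∷ xs)
  hamiltonian two claw free = grow (n G) (proj₂ (proj₂ (initialCycle two))) (ℕₚ.m≤m+n _ _)
    where
    grow : ∀ fuel {u xs} → Cycle u xs → n G ≤ fuel + length xs →
      ∃₂ λ u xs → Cycle u xs × (∀ v → v ∈ u ∷ xs)
    grow zero C n≤ = ⊥-elim (ℕₚ.1+n≰n (≤-trans (unique-length (Cycle.unique C)) n≤))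
    grow (suc fuel) {u} {xs} C n≤ with Finₚ.all? (λ v → v ∈? (u ∷ xs))
    ... | yes all = u , xs , C , all
    ... | no ¬all with Finₚ.¬∀⟶∃¬ _ (_∈ u ∷ xs) (λ v → v ∈? (u ∷ xs)) ¬all
    ... | x , x∉ with extend two claw free C x∉
    ... | v , ys , C′ , l = grow fuel C′
      (≤-trans n≤ (≤-trans (ℕₚ.≤-reflexive (sym (ℕₚ.+-suc fuel _))) (ℕₚ.+-monoʳ-≤ fuel l)))

  -- Chords of a Hamiltonian cycle

  -- A Hamiltonian cycle of length suc P, parametrised periodically by ℕ.
  record Ham (P : ℕ) (c : ℕ → V) : Set where
    field
      period     : ∀ i → c (i + suc P) ≡ c i
      consec     : ∀ i → E (c i) (c (suc i))
      injective  : ∀ {i j} → i < suc P → j < suc P → c i ≡ c j → i ≡ j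
      surjective : ∀ v → ∃ λ i → i < suc P × c i ≡ v

  walk-lookup : ∀ {u xs v} → Walk u xs v → ∀ (k k′ : Fin (suc (length xs))) →
    toℕ k′ ≡ suc (toℕ k) → E (lookup (u ∷ xs) k) (lookup (u ∷ xs) k′)
  walk-lookup [] zero (suc ()) _
  walk-lookup (e ∷ w) zero (suc zero) _ = e
  walk-lookup (e ∷ w) (suc k) (suc k′) eq = walk-lookup w k k′ (ℕₚ.suc-injective eq)
  walk-lookup _ zero zero ()
  walk-lookup (_ ∷ _) zero (suc (suc k)) ()
  walk-lookup _ (suc k) zero ()

  walk-final : ∀ {u xs v} → Walk u xs v → ∀ k → toℕ k ≡ length xs → lookup (u ∷ xs) k ≡ v
  walk-final [] zero _ = refl
  walk-final (_ ∷ w) (suc k) eq = walk-final w k (ℕₚ.suc-injective eq)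

  toHam : ∀ {u xs} → Cycle u xs → (∀ v → v ∈ u ∷ xs) → ∃ (Ham (length xs))
  toHam {u} {xs} (cycle w closing uq) all = c , record
    { period = λ i → cong (lookup (u ∷ xs)) (cyclicIndex-periodic i)
    ; consec = λ i → consec (cyclicIndex i)
    ; injective = λ {i} {j} i< j< eq → trans (sym (toℕ-cyclicIndex i i<))
        (trans (cong toℕ (lookup-injective uq eq)) (toℕ-cyclicIndex j j<))
    ; surjective = λ v → toℕ (index (all v)) , Finₚ.toℕ<n (index (all v)) ,
        trans (cong (lookup (u ∷ xs)) (toℕ-injective (toℕ-cyclicIndex _ (Finₚ.toℕ<n (index (all v))))))
              (sym (lookup-index (all v)))
    }
    where
    c : ℕ → V
    c i = lookup (u ∷ xs) (cyclicIndex i)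
    consec : ∀ k → E (lookup (u ∷ xs) k) (lookup (u ∷ xs) (next k))
    consec k with suc (toℕ k) <? suc (length xs)
    ... | yes l = walk-lookup w k (fromℕ< l) (Finₚ.toℕ-fromℕ< l)
    ... | no ¬l = subst (λ x → E x u) (sym (walk-final w k
                    (ℕₚ.≤-antisym (ℕₚ.≤-pred (Finₚ.toℕ<n k)) (ℕₚ.≤-pred (ℕₚ.≮⇒≥ ¬l))))) closing

  -- Segments, rotations and reflections of a Hamiltonian cycle

  segment : ∀ {f : ℕ → V} → (∀ i → E (f i) (f (suc i))) → ∀ m →
    Walk (f 0) (applyUpTo (f ∘ suc) m) (f m)
  segment con zero = []
  segment con (suc m) = con 0 ∷ segment (con ∘ suc) m

  shift-consec : ∀ {f : ℕ → V} → (∀ i → E (f i) (f (suc i))) → ∀ m i → E (f (m + i)) (f (m + suc i))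
  shift-consec {f} con m i = subst (λ x → E (f (m + i)) (f x)) (sym (ℕₚ.+-suc m i)) (con (m + i))

  -- The index `suc m + 0` is the form in which the start of the following segment appears when
  -- segments are shifted one after another.
  last-consec : ∀ {f : ℕ → V} → (∀ i → E (f i) (f (suc i))) → ∀ m → E (f m) (f (suc m + 0))
  last-consec {f} con m = subst (λ x → E (f m) (f x)) (sym (ℕₚ.+-identityʳ (suc m))) (con m)

  module _ {P : ℕ} where

    period* : ∀ {c} → Ham P c → ∀ j k → c (j + k * suc P) ≡ c j
    period* {c} H j zero = cong c (ℕₚ.+-identityʳ j)
    period* {c} H j (suc k) = trans (cong c (lem j k P)) (trans (Ham.period H _) (period* H j k))
      where
      lem : ∀ j k P → j + suc k * suc P ≡ j + k * suc P + suc P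
      lem = solve-∀

    rotate₁ : ∀ {c} → Ham P c → Ham P (c ∘ suc)
    rotate₁ {c} H = record { period = λ i → period (suc i) ; consec = λ i → consec (suc i)
                           ; injective = inj ; surjective = surj }
      where
      open Ham H
      wrap : ∀ {i} → i < suc P → suc i < suc P ⊎ i ≡ P
      wrap l = [ inj₁ ∘ s≤s , inj₂ ]′ (ℕₚ.m≤n⇒m<n∨m≡n (ℕₚ.≤-pred l))
      inj : ∀ {i j} → i < suc P → j < suc P → c (suc i) ≡ c (suc j) → i ≡ j
      inj i< j< eq with wrap i< | wrap j<
      ... | inj₁ l | inj₁ m = ℕₚ.suc-injective (injective l m eq)
      ... | inj₂ refl | inj₂ refl = refl
      ... | inj₂ refl | inj₁ m with injective z<s m (trans (sym (period 0)) eq)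
      ... | ()
      inj i< j< eq | inj₁ l | inj₂ refl with injective l z<s (trans eq (period 0))
      ... | ()
      surj : ∀ v → ∃ λ i → i < suc P × c (suc i) ≡ v
      surj v with surjective v
      ... | zero , _ , eq = P , n<1+n P , trans (period 0) eq
      ... | suc i , l , eq = i , ℕₚ.<-trans (n<1+n i) l , eq

    rotate : ∀ {c} → Ham P c → ∀ r → Ham P (λ i → c (r + i))
    rotate H zero = H
    rotate H (suc r) = rotate (rotate₁ H) r

    -- A product in place of a truncated subtraction makes the formula meaningful for all `i`, so
    -- periodicity stays a ring identity.
    reflected : (ℕ → V) → ℕ → V
    reflected c i = c (P * suc i)

    -- P is −1 modulo suc P, so P * suc i represents P − i.
    reflected-≡ : ∀ {c} → Ham P c → ∀ i j → i + j ≡ P → reflected c i ≡ c j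
    reflected-≡ {c} H i j refl = trans (cong c (lem i j)) (period* H j i)
      where
      lem : ∀ i j → (i + j) * suc i ≡ j + i * suc (i + j)
      lem = solve-∀

    reflect : ∀ {c} → Ham P c → Ham P (reflected c)
    reflect {c} H = record { period = per ; consec = con ; injective = inj ; surjective = surj }
      where
      open Ham H
      per : ∀ i → c (P * suc (i + suc P)) ≡ c (P * suc i)
      per i = trans (cong c (lem i P)) (period* H (P * suc i) P)
        where
        lem : ∀ i P → P * suc (i + suc P) ≡ P * suc i + P * suc P
        lem = solve-∀
      con : ∀ i → E (c (P * suc i)) (c (P * suc (suc i)))
      con i = E-sym (subst (E (c (P * suc (suc i)))) (trans (cong c (lem i P)) (period (P * suc i))) (consec (P * suc (suc i))))
        where
        lem : ∀ i P → suc (P * suc (suc i)) ≡ P * suc i + suc P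
        lem = solve-∀
      complement : ∀ {i} → i < suc P → ∃ λ j → i + j ≡ P
      complement l = ℕₚ.m≤n⇒∃[o]m+o≡n (ℕₚ.≤-pred l)
      complement-< : ∀ {i j} → i + j ≡ P → j < suc P
      complement-< {i} {j} refl = s≤s (ℕₚ.m≤n+m j i)
      inj : ∀ {i j} → i < suc P → j < suc P → c (P * suc i) ≡ c (P * suc j) → i ≡ j
      inj {i} {j} i< j< eq with complement i< | complement j<
      ... | i′ , ei | j′ , ej with injective (complement-< ei) (complement-< {j} ej)
                                     (trans (sym (reflected-≡ H i i′ ei)) (trans eq (reflected-≡ H j j′ ej)))
      ... | refl = ℕₚ.+-cancelʳ-≡ i′ i j (trans ei (sym ej))
      surj : ∀ v → ∃ λ i → i < suc P × c (P * suc i) ≡ v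
      surj v with surjective v
      ... | j , j< , eq with complement j<
      ... | i , ei = i , complement-< {j} ei , trans (reflected-≡ H i j (trans (ℕₚ.+-comm i j) ei)) eq

  -- Crossing chords and outerplanarity

  applyUpTo-++ : ∀ (f : ℕ → V) m k → applyUpTo f (m + k) ≡ applyUpTo f m ++ applyUpTo (λ x → f (m + x)) k
  applyUpTo-++ f zero k = refl
  applyUpTo-++ f (suc m) k = cong (f 0 ∷_) (applyUpTo-++ (f ∘ suc) m k)

  -- The four chord ends cut the cycle into segments of lengths `suc a`, `suc b`, `suc d`, `suc e`,
  -- each starting at an end. Cyclically consecutive segments touch along the cycle, opposite ones
  -- through the chords.
  chords-cross-minor : ∀ {P c} → Ham P c → ∀ a b d e → suc a + (suc b + (suc d + suc e)) ≡ suc P →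
    E (c 0) (c (suc a + (suc b + 0))) → E (c (suc a + 0)) (c (suc a + (suc b + (suc d + 0)))) →
    Minor K4 G
  chords-cross-minor {P} {c} H a b d e refl chord chord′ =
    cross-minor (segment con₀ a) (segment con₁ b) (segment con₂ d) (segment con₃ e)
      (subst Unique split (Uniqueₚ.applyUpTo⁺₁ c (suc P) λ i<j j<N eq → ℕₚ.<⇒≢ i<j (injective (ℕₚ.<-trans i<j j<N) j<N eq)))
      (_ , _ , last∈ (segment con₀ a) , here refl , last-consec con₀ a)
      (_ , _ , last∈ (segment con₁ b) , here refl , last-consec con₁ b)
      (_ , _ , last∈ (segment con₂ d) , here refl , last-consec con₂ d)
      (_ , _ , last∈ (segment con₃ e) , here refl , close)
      (_ , _ , here refl , here refl , chord)
      (_ , _ , here refl , here refl , chord′)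
    where
    open Ham H
    c₁ c₂ c₃ : ℕ → V
    c₁ x = c (suc a + x)
    c₂ x = c₁ (suc b + x)
    c₃ x = c₂ (suc d + x)
    con₀ : ∀ i → E (c i) (c (suc i))
    con₀ = consec
    con₁ : ∀ i → E (c₁ i) (c₁ (suc i))
    con₁ = shift-consec con₀ (suc a)
    con₂ : ∀ i → E (c₂ i) (c₂ (suc i))
    con₂ = shift-consec con₁ (suc b)
    con₃ : ∀ i → E (c₃ i) (c₃ (suc i))
    con₃ = shift-consec con₂ (suc d)
    close : E (c₃ e) (c 0)
    close = subst (E (c₃ e)) (period 0) (con₃ e)
    split : applyUpTo c (suc a + (suc b + (suc d + suc e))) ≡
      applyUpTo c (suc a) ++ applyUpTo c₁ (suc b) ++ applyUpTo c₂ (suc d) ++ applyUpTo c₃ (suc e)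
    split = trans (applyUpTo-++ c (suc a) _) (cong (applyUpTo c (suc a) ++_)
      (trans (applyUpTo-++ c₁ (suc b) _) (cong (applyUpTo c₁ (suc b) ++_) (applyUpTo-++ c₂ (suc d) _))))

  module _ (free : MinorFree G K4) {P : ℕ} where

    noCrossing₀ : ∀ {c} → Ham P c → ∀ {j k l} → 0 < j → j < k → k < l → l < suc P →
      E (c 0) (c k) → E (c j) (c l) → ⊥
    noCrossing₀ {c} H {suc a} z<s j<k k<l l<N 0k jl
      with ℕₚ.m≤n⇒∃[o]m+o≡n j<k | ℕₚ.m≤n⇒∃[o]m+o≡n k<l | ℕₚ.m≤n⇒∃[o]m+o≡n l<N
    ... | b , refl | d , refl | e , eq = free (chords-cross-minor H a b d e (trans (lem₀ a b d e) eq)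
            (subst (λ x → E (c 0) (c x)) (lem₁ a b) 0k)
            (subst₂ (λ x y → E (c x) (c y)) (lem₂ a) (lem₃ a b d) jl))
      where
      lem₀ : ∀ a b d e → suc a + (suc b + (suc d + suc e)) ≡ suc (suc (suc (suc a) + b) + d) + e
      lem₀ = solve-∀
      lem₁ : ∀ a b → suc (suc a) + b ≡ suc a + (suc b + 0)
      lem₁ = solve-∀
      lem₂ : ∀ a → suc a ≡ suc a + 0
      lem₂ = solve-∀
      lem₃ : ∀ a b d → suc (suc (suc a) + b) + d ≡ suc a + (suc b + (suc d + 0))
      lem₃ = solve-∀

    -- Rotation by `i` moves the first end to 0. The indices may thus run past the end of the cycle,
    -- provided that they stay within one period from `i`.
    noCrossing : ∀ {c} → Ham P c → ∀ {i j k l} → i < j → j < k → k < l → l < i + suc P →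
      E (c i) (c k) → E (c j) (c l) → ⊥
    noCrossing {c} H {i} i<j j<k k<l l<iN ik jl
      with ℕₚ.m≤n⇒∃[o]m+o≡n (ℕₚ.<⇒≤ i<j) | ℕₚ.m≤n⇒∃[o]m+o≡n (ℕₚ.<⇒≤ (ℕₚ.<-trans i<j j<k))
         | ℕₚ.m≤n⇒∃[o]m+o≡n (ℕₚ.<⇒≤ (ℕₚ.<-trans (ℕₚ.<-trans i<j j<k) k<l))
    ... | j′ , refl | k′ , refl | l′ , refl = noCrossing₀ (rotate H i)
      (ℕₚ.+-cancelˡ-< i 0 j′ (subst (_< i + j′) (sym (ℕₚ.+-identityʳ i)) i<j))
      (ℕₚ.+-cancelˡ-< i j′ k′ j<k) (ℕₚ.+-cancelˡ-< i k′ l′ k<l) (ℕₚ.+-cancelˡ-< i l′ (suc P) l<iN)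
      (subst (λ x → E (c x) (c (i + k′))) (sym (ℕₚ.+-identityʳ i)) ik) jl

    -- The circular order is that of the Hamiltonian cycle, where crossing edges are excluded by
    -- `noCrossing`.
    outerplanar : ∀ {c} → Ham P c → Outerplanar G
    outerplanar {c} H = pos , (λ {u} {v} → pos-injective {u} {v}) , uncrossed
      where
      open Ham H
      ix : V → ℕ
      ix v = proj₁ (surjective v)
      ix-< : ∀ v → ix v < suc P
      ix-< v = proj₁ (proj₂ (surjective v))
      c-ix : ∀ v → c (ix v) ≡ v
      c-ix v = proj₂ (proj₂ (surjective v))
      -- Indices on the cycle are below `suc P`; this bound makes them legitimate positions in
      -- `Fin (n G)`.
      N≤n : suc P ≤ n G
      N≤n = injective⇒≤ {f = λ k → c (toℕ k)} (λ {i} {j} eq → toℕ-injective (injective (Finₚ.toℕ<n i) (Finₚ.toℕ<n j) eq))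
      ix-<n : ∀ v → ix v < n G
      ix-<n v = ≤-trans (ix-< v) N≤n
      pos : V → V
      pos v = fromℕ< (ix-<n v)
      toℕ-pos : ∀ v → toℕ (pos v) ≡ ix v
      toℕ-pos v = Finₚ.toℕ-fromℕ< (ix-<n v)
      pos-injective : ∀ {u v} → pos u ≡ pos v → u ≡ v
      pos-injective {u} {v} eq = trans (sym (c-ix u)) (trans (cong c
        (trans (sym (toℕ-pos u)) (trans (cong toℕ eq) (toℕ-pos v)))) (c-ix v))
      uncrossed : ∀ a b c d → adj G a b ≡ true → adj G c d ≡ true →
        ¬ (toℕ (pos a) < toℕ (pos c) × toℕ (pos c) < toℕ (pos b) × toℕ (pos b) < toℕ (pos d))
      uncrossed a b x d ab xd (l , m , r) rewrite toℕ-pos a | toℕ-pos b | toℕ-pos x | toℕ-pos d =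
        noCrossing H l m r (≤-trans (ix-< d) (ℕₚ.m≤n+m _ _))
          (subst₂ E (sym (c-ix a)) (sym (c-ix b)) ab) (subst₂ E (sym (c-ix x)) (sym (c-ix d)) xd)

  -- The target graphs are matched by numbering the vertices of `G`, that is, by a map out of `H`;
  -- the isomorphism is its inverse.
  ≅-from : (H : Graph) (g : Fin (n H) → V) → Injective _≡_ _≡_ g → (∀ v → ∃ λ u → g u ≡ v) →
    (∀ i j → adj G (g i) (g j) ≡ adj H i j) → G ≅ H
  ≅-from H g inj surj pres = f , (f-injective , f-surjective) ,
    λ u v → trans (sym (pres (f u) (f v))) (cong₂ (adj G) (g∘f u) (g∘f v))
    where
    f : V → Fin (n H)
    f v = proj₁ (surj v)
    g∘f : ∀ v → g (f v) ≡ v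
    g∘f v = proj₂ (surj v)
    f-injective : ∀ {u v} → f u ≡ f v → u ≡ v
    f-injective {u} {v} eq = trans (sym (g∘f u)) (trans (cong g eq) (g∘f v))
    f-surjective : ∀ w → ∃ λ v → ∀ {z} → z ≡ v → f z ≡ w
    f-surjective w = g w , λ { refl → inj (g∘f (g w)) }

  -- Zigzag triangulations: Z_d and Z*_d

  module Zigzag (claw : ClawFree) (free : MinorFree G K4) {m : ℕ} where

    distinct : ∀ {c} → Ham (suc m) c → ∀ {i j} → i < j → j < 2 + m → c i ≢ c j
    distinct H i<j j<N eq = ℕₚ.<⇒≢ i<j (Ham.injective H (ℕₚ.<-trans i<j j<N) j<N eq)

    consec-last : ∀ {c} → Ham (suc m) c → E (c 0) (c (suc m))
    consec-last {c} H = E-sym (subst (E (c (suc m))) (Ham.period H 0) (Ham.consec H (suc m)))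

    -- The ear with tip c (suc m) sits on a triangle with third vertex c 1.
    EarPair : (ℕ → V) → Set
    EarPair c = E (c 0) (c m) × E (c 1) (c m)

    -- The cycle has N = m + 2 vertices, so the sums are N - 1 and N - 2. The pair 0, N - 1 of the
    -- first sum is the closing edge.
    Zig : (ℕ → V) → Set
    Zig c = ∀ {i j} → i < j → j < 2 + m →
      E (c i) (c j) ⇔ (j ≡ suc i ⊎ i + j ≡ suc m ⊎ i + j ≡ m)

    -- Claw-freeness at the ends of the chord gives a triangle on its short side,
    -- hence a shorter chord, until the side is a triangle and an ear.
    longChord⇒earPair : ∀ q {c} → Ham (suc m) c → 4 + q ≤ m → E (c 0) (c (3 + q)) →
      ∃ λ c′ → Ham (suc m) c′ × EarPair c′
    longChord⇒earPair q {c} H q<m chord = cases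
        (claw (distinct H (s<s (≤-trans z<s q<m)) 1+m<N) (distinct H (s<s z<s) 3+q<N) (≢-sym (distinct H 3+q<1+m 1+m<N))
              (consec 0) (consec-last H) chord)
      where
      open Ham H
      1+m<N : 1 + m < 2 + m
      1+m<N = n<1+n _
      3+q<1+m : 3 + q < 1 + m
      3+q<1+m = ℕₚ.m<n⇒m<1+n q<m
      3+q<N : 3 + q < 2 + m
      3+q<N = ℕₚ.m<n⇒m<1+n 3+q<1+m

      right : ∀ q → 4 + q ≤ m → E (c 0) (c (3 + q)) → E (c 1) (c (3 + q)) → ∃ λ c′ → Ham (suc m) c′ × EarPair c′
      right (suc q) q<m _ e = longChord⇒earPair q (rotate H 1) (ℕₚ.<⇒≤ q<m) e
      -- The ear has tip `c 2` and sits on the triangle with third vertex `c 0`. Reading the cycle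
      -- backwards from `c 1` gives the tip index `suc m`.
      right zero q<m chord e = c″ , H″ , subst₂ E (sym c″0) (sym c″m) e , subst₂ E (sym c″1) (sym c″m) chord
        where
        c′ c″ : ℕ → V
        c′ i = c (2 + i)
        c″ = reflected {suc m} c′
        H′ : Ham (suc m) c′
        H′ = rotate H 2
        H″ : Ham (suc m) c″
        H″ = reflect H′
        c″0 : c″ 0 ≡ c 1
        c″0 = trans (reflected-≡ H′ 0 (suc m) refl) (period 1)
        c″1 : c″ 1 ≡ c 0
        c″1 = trans (reflected-≡ H′ 1 m refl) (period 0)
        c″m : c″ m ≡ c 3
        c″m = reflected-≡ H′ m 1 (ℕₚ.+-comm m 1)

      left : ∀ q → 4 + q ≤ m → E (c 0) (c (3 + q)) → E (c (2 + q)) (c 0) → ∃ λ c′ → Ham (suc m) c′ × EarPair c′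
      left (suc q) q<m _ e = longChord⇒earPair q H (ℕₚ.<⇒≤ q<m) (E-sym e)
      -- The ear has tip `c 1` and sits on the triangle with third vertex `c 3`. Numbering from
      -- `c 2` gives the tip index `suc m`.
      left zero q<m chord e = (λ i → c (2 + i)) , rotate H 2 ,
        subst (E (c 2)) (sym (period 0)) e , subst (E (c 3)) (sym (period 0)) (E-sym chord)

      cases : E (c 1) (c (suc m)) ⊎ E (c 1) (c (3 + q)) ⊎ E (c (suc m)) (c (3 + q)) →
        ∃ λ c′ → Ham (suc m) c′ × EarPair c′
      cases (inj₁ e) = ⊥-elim (noCrossing₀ free H z<s (s<s z<s) 3+q<1+m 1+m<N chord e)
      cases (inj₂ (inj₁ e)) = right q q<m chord e
      -- The triangle at `c 0` lies on the far side of the chord. Claw-freeness is then used at the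
      -- other end `c (3 + q)`, where a triangle on the far side would cross `e`.
      cases (inj₂ (inj₂ e)) with claw
        (distinct H (ℕₚ.m<n⇒m<1+n (n<1+n (2 + q))) 4+q<N)
        (≢-sym (distinct H z<s (ℕₚ.<-trans (n<1+n _) 3+q<N))) (≢-sym (distinct H z<s 4+q<N))
        (E-sym (consec (2 + q))) (consec (3 + q)) (E-sym chord)
        where
        4+q<N : 4 + q < 2 + m
        4+q<N = s≤s (ℕₚ.m≤n⇒m≤1+n q<m)
      ... | inj₁ f = ⊥-elim (noCrossing₀ free H z<s (n<1+n _) (n<1+n _) (s≤s (ℕₚ.m≤n⇒m≤1+n q<m)) chord f)
      ... | inj₂ (inj₁ f) = left q q<m chord f
      ... | inj₂ (inj₂ f) = ⊥-elim (noCrossing₀ free H z<s (n<1+n _) (s≤s q<m) 1+m<N (E-sym f) (E-sym e))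

    module _ {c : ℕ → V} (H : Ham (suc m) c) where
      open Ham H

      -- The chords at `k` of index sum N - 2 and N - 1; the zigzag alternates between the two
      -- kinds.
      Low High : ℕ → Set
      Low k = ∀ {x} → k + x ≡ m → k < x → E (c k) (c x)
      High k = ∀ {x} → k + x ≡ suc m → k < x → E (c k) (c x)

      -- Claw-freeness at `c (suc x)`, the far end of both known chords: among its neighbours `c x`,
      -- `c (2 + x)` and `c (suc k)`, an edge at `c (2 + x)` would cross the low chord of `k`.
      low-step : ∀ k → Low k → High (suc k) → Low (suc k)
      low-step k low high {x} sum 1+k<x =
        cases (claw (distinct H (ℕₚ.m<n⇒m<1+n (n<1+n x)) 2+x<N) (≢-sym (distinct H 1+k<x x<N))
                    (≢-sym (distinct H (ℕₚ.<-trans 1+k<x (ℕₚ.m<n⇒m<1+n (n<1+n x))) 2+x<N))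
                    (E-sym (consec x)) (consec (suc x)) (E-sym e₁))
        where
        k<x : k < x
        k<x = ℕₚ.<-trans (n<1+n k) 1+k<x
        x<m : x < m
        x<m = subst (x <_) sum (s≤s (ℕₚ.m≤n+m x k))
        2+x<N : 2 + x < 2 + m
        2+x<N = s≤s (s≤s x<m)
        x<N : x < 2 + m
        x<N = ℕₚ.m<n⇒m<1+n (ℕₚ.m<n⇒m<1+n x<m)
        2+x<k+N : 2 + x < k + (2 + m)
        2+x<k+N = ≤-trans 2+x<N (ℕₚ.m≤n+m _ k)
        e₀ : E (c k) (c (suc x))
        e₀ = low (trans (ℕₚ.+-suc k x) sum) (ℕₚ.m<n⇒m<1+n k<x)
        e₁ : E (c (suc k)) (c (suc x))
        e₁ = high (cong suc (trans (ℕₚ.+-suc k x) sum)) (ℕₚ.m<n⇒m<1+n 1+k<x)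
        cases : E (c x) (c (2 + x)) ⊎ E (c x) (c (suc k)) ⊎ E (c (2 + x)) (c (suc k)) → E (c (suc k)) (c x)
        cases (inj₁ e) = ⊥-elim (noCrossing free H k<x (n<1+n x) (n<1+n _) 2+x<k+N e₀ e)
        cases (inj₂ (inj₁ e)) = E-sym e
        cases (inj₂ (inj₂ e)) = ⊥-elim (noCrossing free H (n<1+n k) (ℕₚ.m<n⇒m<1+n 1+k<x) (n<1+n _) 2+x<k+N e₀ (E-sym e))

      -- Claw-freeness at `c (suc k)`, the near end of both known chords: among its neighbours
      -- `c k`, `c (2 + k)` and `c x`, an edge at `c k` would cross the high chord of `suc k`.
      high-step : ∀ k → Low (suc k) → High (suc k) → High (2 + k)
      high-step k low high {x} sum 2+k<x =
        cases (claw (distinct H (ℕₚ.m<n⇒m<1+n (n<1+n k)) (ℕₚ.<-trans 2+k<x x<N))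
                    (distinct H (ℕₚ.<-trans (n<1+n k) 1+k<x) x<N) (distinct H 2+k<x x<N)
                    (E-sym (consec k)) (consec (suc k)) e₀)
        where
        sum′ : suc k + x ≡ m
        sum′ = ℕₚ.suc-injective sum
        1+k<x : suc k < x
        1+k<x = ℕₚ.<-trans (n<1+n _) 2+k<x
        x<m : x < m
        x<m = subst (x <_) sum′ (s≤s (ℕₚ.m≤n+m x k))
        x<N : x < 2 + m
        x<N = ℕₚ.m<n⇒m<1+n (ℕₚ.m<n⇒m<1+n x<m)
        1+x<k+N : suc x < k + (2 + m)
        1+x<k+N = ≤-trans (s≤s (ℕₚ.m<n⇒m<1+n x<m)) (ℕₚ.m≤n+m _ k)
        e₀ : E (c (suc k)) (c x)
        e₀ = low sum′ 1+k<x
        e₁ : E (c (suc k)) (c (suc x))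
        e₁ = high (trans (ℕₚ.+-suc (suc k) x) (cong suc sum′)) (ℕₚ.m<n⇒m<1+n 1+k<x)
        cases : E (c k) (c (2 + k)) ⊎ E (c k) (c x) ⊎ E (c (2 + k)) (c x) → E (c (2 + k)) (c x)
        cases (inj₁ e) = ⊥-elim (noCrossing free H (n<1+n k) (n<1+n _) (ℕₚ.m<n⇒m<1+n 2+k<x) 1+x<k+N e e₁)
        cases (inj₂ (inj₁ e)) = ⊥-elim (noCrossing free H (n<1+n k) 1+k<x (n<1+n x) 1+x<k+N e e₁)
        cases (inj₂ (inj₂ e)) = e

      -- The induction runs on the pair, since each step needs chords of both kinds; the ear pair is
      -- the case 0.
      zigzag : EarPair c → ∀ k → Low k × High (suc k)
      zigzag (e , f) zero = (λ { refl _ → e }) , λ { refl _ → f }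
      zigzag ear (suc k) with zigzag ear k
      ... | low , high = low′ , high-step k low′ high
        where
        low′ : Low (suc k)
        low′ = low-step k low high

      -- The zigzag leaves no room for further chords: one of smaller index sum crosses the high
      -- chord at `suc i`, one of larger sum crosses the low chord that ends just before `j`.
      earPair⇒zig : EarPair c → Zig c
      earPair⇒zig ear {i} {j} i<j j<N = mk⇔ forward backward
        where
        low : ∀ k → Low k
        low k = proj₁ (zigzag ear k)
        high : ∀ k → High k
        -- For `k` = 0 the sum N - 1 gives the closing edge of the cycle.
        high zero refl _ = consec-last H
        high (suc k) = proj₂ (zigzag ear k)
        backward : j ≡ suc i ⊎ i + j ≡ suc m ⊎ i + j ≡ m → E (c i) (c j)
        backward (inj₁ refl) = consec i
        backward (inj₂ (inj₁ s)) = high i s i<j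
        backward (inj₂ (inj₂ s)) = low i s i<j
        inside : suc i < j → i + j < m → E (c i) (c j) → ⊥
        inside 1+i<j sum e with ℕₚ.m≤n⇒∃[o]m+o≡n (≤-trans (ℕₚ.m≤m+n i j) (ℕₚ.<⇒≤ sum))
        ... | x , refl = noCrossing free H (n<1+n i) 1+i<j j<x x<i+N e (high (suc i) refl (ℕₚ.<-trans 1+i<j j<x))
          where
          j<x : j < x
          j<x = ℕₚ.+-cancelˡ-< i j x sum
          x<i+N : x < i + (2 + (i + x))
          x<i+N = ≤-trans (s≤s (≤-trans (ℕₚ.m≤n+m x i) (ℕₚ.n≤1+n _))) (ℕₚ.m≤n+m _ i)
        outside : ∀ j′ → j ≡ suc j′ → suc i < j → suc m < i + j → E (c i) (c j) → ⊥
        outside j′ refl 1+i<j sum e with ℕₚ.m≤n⇒∃[o]m+o≡n (ℕₚ.≤-pred (ℕₚ.≤-pred j<N))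
        ... | y , sum′ = noCrossing free H y<i i<j′ (n<1+n j′) (≤-trans j<N (ℕₚ.m≤n+m _ y))
                           (low y (trans (ℕₚ.+-comm y j′) sum′) (ℕₚ.<-trans y<i i<j′)) e
          where
          i<j′ : i < j′
          i<j′ = ℕₚ.≤-pred 1+i<j
          y<i : y < i
          y<i = ℕₚ.+-cancelʳ-< j′ y i (subst (_< i + j′) (trans (sym sum′) (ℕₚ.+-comm j′ y))
                  (ℕₚ.≤-pred (subst (suc m <_) (ℕₚ.+-suc i j′) sum)))
        pred-of : ∀ {i j} → i < j → ∃ λ j′ → j ≡ suc j′
        pred-of (s≤s _) = _ , refl
        forward : E (c i) (c j) → j ≡ suc i ⊎ i + j ≡ suc m ⊎ i + j ≡ m
        forward e with ℕₚ.m≤n⇒m<n∨m≡n i<j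
        ... | inj₂ s = inj₁ (sym s)
        ... | inj₁ 1+i<j with <-cmp (i + j) m
        ... | tri≈ _ s _ = inj₂ (inj₂ s)
        ... | tri< l _ _ = ⊥-elim (inside 1+i<j l e)
        ... | tri> _ _ l with ℕₚ.m≤n⇒m<n∨m≡n l
        ... | inj₂ s = inj₂ (inj₁ (sym s))
        ... | inj₁ l′ = ⊥-elim (outside (proj₁ (pred-of i<j)) (proj₂ (pred-of i<j)) 1+i<j l′ e)

      fromCycle : (H′ : Graph) → n H′ ≡ 2 + m →
        (∀ {u v} → toℕ u < toℕ v → E (c (toℕ u)) (c (toℕ v)) ⇔ adj H′ u v ≡ true) → G ≅ H′
      fromCycle H′ size edges = ≅-from H′ (c ∘ toℕ) inj surj
          (preserves-adj H′ (c ∘ toℕ) λ i j i<j → ⇔→≡ (edges i<j))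
        where
        bound : (u : Fin (n H′)) → toℕ u < 2 + m
        bound u = subst (toℕ u <_) size (Finₚ.toℕ<n u)
        inj : Injective _≡_ _≡_ (c ∘ toℕ)
        inj {u} {v} eq = toℕ-injective (injective (bound u) (bound v) eq)
        surj : ∀ v → ∃ λ u → c (toℕ u) ≡ v
        surj v with surjective v
        ... | i , i<N , eq = fromℕ< i<n , trans (cong c (Finₚ.toℕ-fromℕ< i<n)) eq
          where
          i<n : i < n H′
          i<n = subst (i <_) (sym size) i<N

      zig⇒Zg : Zig c → ∀ d → d + d ≡ suc m → G ≅ Zg d
      zig⇒Zg zig d eq = fromCycle (Zg d) (cong suc eq) λ {u} {v} u<v →
        mk⇔ (from (Zg-adj d u<v) ∘ fwd ∘ to (zig u<v (bound v))) (from (zig u<v (bound v)) ∘ bwd ∘ to (Zg-adj d u<v))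
        where
        bound : (v : Fin (suc (d + d))) → toℕ v < 2 + m
        bound v = subst (toℕ v <_) (cong suc eq) (Finₚ.toℕ<n v)
        fwd : ∀ {A : Set} {s} → A ⊎ s ≡ suc m ⊎ s ≡ m → A ⊎ s ≡ d + d ⊎ suc s ≡ d + d
        fwd (inj₁ a) = inj₁ a
        fwd (inj₂ (inj₁ e)) = inj₂ (inj₁ (trans e (sym eq)))
        fwd (inj₂ (inj₂ e)) = inj₂ (inj₂ (trans (cong suc e) (sym eq)))
        bwd : ∀ {A : Set} {s} → A ⊎ s ≡ d + d ⊎ suc s ≡ d + d → A ⊎ s ≡ suc m ⊎ s ≡ m
        bwd (inj₁ a) = inj₁ a
        bwd (inj₂ (inj₁ e)) = inj₂ (inj₁ (trans e eq))
        bwd (inj₂ (inj₂ e)) = inj₂ (inj₂ (ℕₚ.suc-injective (trans e eq)))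

      zig⇒Zstar : Zig c → ∀ d → d + d ≡ 2 + m → G ≅ Zstar d
      zig⇒Zstar zig d eq = fromCycle (Zstar d) eq λ {u} {v} u<v →
        mk⇔ (from (Zstar-adj d u<v) ∘ fwd ∘ to (zig u<v (bound v))) (from (zig u<v (bound v)) ∘ bwd ∘ to (Zstar-adj d u<v))
        where
        bound : (v : Fin (d + d)) → toℕ v < 2 + m
        bound v = subst (toℕ v <_) eq (Finₚ.toℕ<n v)
        fwd : ∀ {A : Set} {s} → A ⊎ s ≡ suc m ⊎ s ≡ m → A ⊎ suc s ≡ d + d ⊎ suc (suc s) ≡ d + d
        fwd (inj₁ a) = inj₁ a
        fwd (inj₂ (inj₁ e)) = inj₂ (inj₁ (trans (cong suc e) (sym eq)))
        fwd (inj₂ (inj₂ e)) = inj₂ (inj₂ (trans (cong (2 +_) e) (sym eq)))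
        bwd : ∀ {A : Set} {s} → A ⊎ suc s ≡ d + d ⊎ suc (suc s) ≡ d + d → A ⊎ s ≡ suc m ⊎ s ≡ m
        bwd (inj₁ a) = inj₁ a
        bwd (inj₂ (inj₁ e)) = inj₂ (inj₁ (ℕₚ.suc-injective (trans e eq)))
        bwd (inj₂ (inj₂ e)) = inj₂ (inj₂ (ℕₚ.suc-injective (ℕₚ.suc-injective (trans e eq))))

      -- With d = e + 1, the length N = m + 2 is 2d for m = 2e, the order of Z*_d, and 2d + 1 for m
      -- = 2e + 1, the order of Z_d.
      zig⇒Z : Zig c → Σ ℕ λ d → 1 ≤ d × ((G ≅ Zg d) ⊎ (G ≅ Zstar d))
      zig⇒Z zig with parity m
        where
        parity : ∀ m → ∃ λ e → m ≡ e + e ⊎ m ≡ suc (e + e)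
        parity zero = 0 , inj₁ refl
        parity (suc m) with parity m
        ... | e , inj₁ eq = e , inj₂ (cong suc eq)
        ... | e , inj₂ eq = suc e , inj₁ (cong suc (trans eq (sym (ℕₚ.+-suc e e))))
      ... | e , inj₁ eq = suc e , s≤s z≤n , inj₂ (zig⇒Zstar zig (suc e) (cong suc (trans (ℕₚ.+-suc e e) (cong suc (sym eq)))))
      ... | e , inj₂ eq = suc e , s≤s z≤n , inj₁ (zig⇒Zg zig (suc e) (cong suc (trans (ℕₚ.+-suc e e) (sym eq))))

  -- For m = 1 an ear pair would contain a loop at `c 1`, so the triangle is checked directly: every
  -- pair is adjacent and meets the index condition.
  triangle-zig : (claw : ClawFree) (free : MinorFree G K4) → ∀ {c} → Ham 2 c → Zigzag.Zig claw free {1} c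
  triangle-zig claw free {c} H {0} {1} _ _ = mk⇔ (λ _ → inj₁ refl) (λ _ → Ham.consec H 0)
  triangle-zig claw free {c} H {0} {2} _ _ = mk⇔ (λ _ → inj₂ (inj₁ refl)) (λ _ → Zigzag.consec-last claw free H)
  triangle-zig claw free {c} H {1} {2} _ _ = mk⇔ (λ _ → inj₁ refl) (λ _ → Ham.consec H 1)
  triangle-zig claw free H {suc _} {1} (s<s ()) _
  triangle-zig claw free H {suc (suc _)} {2} (s<s (s<s ())) _
  triangle-zig claw free H {_} {suc (suc (suc _))} _ (s<s (s<s (s<s ())))

  -- Inner cycles with ears: S_t

  -- The indices after `x` may pass the end of the cycle, so `Near` speaks of cyclic distance one or
  -- two.
  Near : ℕ → (ℕ → V) → V → V → Set
  Near P c u v = ∃ λ x → x < suc P × c x ≡ u × (c (suc x) ≡ v ⊎ c (2 + x) ≡ v)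

  Short : ℕ → (ℕ → V) → Set
  Short P c = ∀ {u v} → E u v → Near P c u v ⊎ Near P c v u

  module Sequence (c : ℕ → V) where

    -- The tip, which the chord cuts off, is `c (suc i)`.
    Ear : ℕ → Set
    Ear i = E (c i) (c (2 + i))

    -- The vertices of the inner cycle are c (s 0), c (s 1), …; ears are skipped.
    s : ℕ → ℕ
    s zero = 0
    s (suc a) with E? (c (s a)) (c (2 + s a))
    ... | yes _ = 2 + s a
    ... | no _ = suc (s a)

    s-ear : ∀ {a} → Ear (s a) → s (suc a) ≡ 2 + s a
    s-ear {a} e with E? (c (s a)) (c (2 + s a))
    ... | yes _ = refl
    ... | no ¬e = ⊥-elim (¬e e)

    s-flat : ∀ {a} → ¬ Ear (s a) → s (suc a) ≡ suc (s a)
    s-flat {a} ¬e with E? (c (s a)) (c (2 + s a))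
    ... | yes e = ⊥-elim (¬e e)
    ... | no _ = refl

    s-suc : ∀ a → s a < s (suc a)
    s-suc a with E? (c (s a)) (c (2 + s a))
    ... | yes _ = ℕₚ.m<n⇒m<1+n (n<1+n _)
    ... | no _ = n<1+n _

    s-double : ∀ a → s a ≤ a + a
    s-double zero = z≤n
    s-double (suc a) rewrite ℕₚ.+-suc a a with E? (c (s a)) (c (2 + s a))
    ... | yes _ = s≤s (s≤s (s-double a))
    ... | no _ = s≤s (ℕₚ.m≤n⇒m≤1+n (s-double a))

    s-mono-< : ∀ {a b} → a < b → s a < s b
    s-mono-< {a} {suc b} (s≤s a≤b) with ℕₚ.m≤n⇒m<n∨m≡n a≤b
    ... | inj₁ a<b = ℕₚ.<-trans (s-mono-< a<b) (s-suc b)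
    ... | inj₂ refl = s-suc b

    s-mono-≤ : ∀ {a b} → a ≤ b → s a ≤ s b
    s-mono-≤ a≤b with ℕₚ.m≤n⇒m<n∨m≡n a≤b
    ... | inj₁ a<b = ℕₚ.<⇒≤ (s-mono-< a<b)
    ... | inj₂ refl = ≤-refl

    s-cancel-< : ∀ {a b} → s a < s b → a < b
    s-cancel-< l = ℕₚ.≰⇒> λ b≤a → ℕₚ.<⇒≱ l (s-mono-≤ b≤a)

    s-injective : ∀ {a b} → s a ≡ s b → a ≡ b
    s-injective {a} {b} eq with <-cmp a b
    ... | tri< l _ _ = ⊥-elim (ℕₚ.<⇒≢ (s-mono-< l) eq)
    ... | tri≈ _ e _ = e
    ... | tri> _ _ l = ⊥-elim (ℕₚ.<⇒≢ (s-mono-< l) (sym eq))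

    decode : ∀ x → ∃ λ a → x ≡ s a ⊎ (x ≡ suc (s a) × Ear (s a))
    decode zero = 0 , inj₁ refl
    decode (suc x) with decode x
    ... | a , inj₂ (eq , e) = suc a , inj₁ (trans (cong suc eq) (sym (s-ear {a} e)))
    ... | a , inj₁ eq with E? (c (s a)) (c (2 + s a))
    ... | yes e = a , inj₂ (cong suc eq , e)
    ... | no ¬e = suc a , inj₁ (trans (cong suc eq) (sym (s-flat {a} ¬e)))

    -- The sequence could miss `suc P` only by jumping over it along an ear at `P`, so it returns
    -- exactly to the starting vertex.
    closes : ∀ {P} → ¬ Ear P → ∃ λ t → s t ≡ suc P
    closes {P} ¬e with decode (suc P)
    ... | t , inj₁ eq = t , sym eq
    ... | a , inj₂ (eq , e) = ⊥-elim (¬e (subst Ear (sym (ℕₚ.suc-injective eq)) e))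

  module InnerCycle (free : MinorFree G K4) {P : ℕ} {c : ℕ → V} (H : Ham P c)
                    (4≤N : 4 ≤ suc P) (short : Short P c)
                    (t : ℕ) (s-t : Sequence.s c t ≡ suc P) where
    open Ham H
    open Sequence c

    -- The subset I in the definition of S_t, listed without repetition so that `lookup` is the
    -- required injection.
    ears : List (Fin t)
    ears = filter (λ a → E? (c (s (toℕ a))) (c (2 + s (toℕ a)))) (allFin t)

    k : ℕ
    k = length ears

    ρ : Fin k → Fin t
    ρ = lookup ears

    ρ-injective : Injective _≡_ _≡_ ρ
    ρ-injective = lookup-injective (Uniqueₚ.filter⁺ _ (Uniqueₚ.allFin⁺ t))

    ρ-ear : ∀ j → Ear (s (toℕ (ρ j)))
    ρ-ear j = proj₂ (∈-filter⁻ (λ a → E? (c (s (toℕ a))) (c (2 + s (toℕ a)))) {xs = allFin t} (∈-lookup {xs = ears} j))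

    ear-ρ : ∀ a → Ear (s (toℕ a)) → ∃ λ j → ρ j ≡ a
    ear-ρ a e = index a∈ , sym (lookup-index a∈)
      where
      a∈ : a ∈ ears
      a∈ = ∈-filter⁺ (λ a → E? (c (s (toℕ a))) (c (2 + s (toℕ a)))) (∈-allFin a) e

    X : Set
    X = Fin t ⊎ Fin k

    pos : X → ℕ
    pos (inj₁ a) = s (toℕ a)
    pos (inj₂ j) = suc (s (toℕ (ρ j)))

    pos-< : ∀ x → pos x < suc P
    pos-< (inj₁ a) = subst (s (toℕ a) <_) s-t (s-mono-< (Finₚ.toℕ<n a))
    pos-< (inj₂ j) = subst₂ _≤_ (s-ear {toℕ (ρ j)} (ρ-ear j)) s-t (s-mono-≤ (Finₚ.toℕ<n (ρ j)))

    -- At an ear the increasing sequence goes from `s b` directly to `2 + s b`.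
    tip≢ : ∀ {a b} → Ear (s b) → s a ≢ suc (s b)
    tip≢ {a} {b} e eq = ℕₚ.<-irrefl (sym eq)
      (subst (_≤ s a) (s-ear {b} e) (s-mono-≤ (s-cancel-< {b} {a} (subst (s b <_) (sym eq) (n<1+n _)))))

    pos-injective : ∀ x y → pos x ≡ pos y → x ≡ y
    pos-injective (inj₁ a) (inj₁ b) eq = cong inj₁ (toℕ-injective (s-injective eq))
    pos-injective (inj₁ a) (inj₂ j) eq = ⊥-elim (tip≢ {toℕ a} {toℕ (ρ j)} (ρ-ear j) eq)
    pos-injective (inj₂ j) (inj₁ a) eq = ⊥-elim (tip≢ {toℕ a} {toℕ (ρ j)} (ρ-ear j) (sym eq))
    pos-injective (inj₂ i) (inj₂ j) eq = cong inj₂ (ρ-injective (toℕ-injective (s-injective (ℕₚ.suc-injective eq))))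

    h : X → V
    h x = c (pos x)

    h-injective : ∀ {x y} → h x ≡ h y → x ≡ y
    h-injective {x} {y} eq = pos-injective x y (injective (pos-< x) (pos-< y) eq)

    h-surjective : ∀ v → ∃ λ x → h x ≡ v
    h-surjective v with surjective v
    ... | i , i<N , refl with decode i
    ... | a , inj₁ refl = inj₁ (fromℕ< a<t) , cong (c ∘ s) (Finₚ.toℕ-fromℕ< a<t)
      where
      a<t : a < t
      a<t = s-cancel-< (subst (s a <_) (sym s-t) i<N)
    ... | a , inj₂ (refl , e) with ear-ρ (fromℕ< a<t) (subst (Ear ∘ s) (sym (Finₚ.toℕ-fromℕ< a<t)) e)
      where
      a<t : a < t
      a<t = s-cancel-< (subst (s a <_) (sym s-t) (ℕₚ.<-trans (n<1+n _) i<N))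
    ... | j , eq = inj₂ j , cong (c ∘ suc ∘ s) (trans (cong toℕ eq) (Finₚ.toℕ-fromℕ< _))

    c-next : ∀ (a : Fin t) → c (s (nextC t (toℕ a))) ≡ c (s (suc (toℕ a)))
    c-next a with suc (toℕ a) ℕₚ.≟ t
    -- After the last inner vertex, `s-t` and the period lead back to `c 0`.
    ... | yes eq = trans (cong (c ∘ s) (nextC-last eq)) (trans (sym (period 0)) (cong c (trans (sym s-t) (cong s (sym eq)))))
    ... | no ne = cong (c ∘ s) (nextC-suc ne)

    next-C< : ∀ (a : Fin t) → nextC t (toℕ a) < t
    next-C< a with suc (toℕ a) ℕₚ.≟ t
    ... | yes eq rewrite nextC-last eq = ℕₚ.≤-<-trans z≤n (Finₚ.toℕ<n a)
    ... | no ne rewrite nextC-suc ne = ℕₚ.≤∧≢⇒< (Finₚ.toℕ<n a) ne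

    succ : Fin t → Fin t
    succ a = fromℕ< (next-C< a)

    toℕ-succ : ∀ a → toℕ (succ a) ≡ nextC t (toℕ a)
    toℕ-succ a = Finₚ.toℕ-fromℕ< (next-C< a)

    h-succ : ∀ a → h (inj₁ (succ a)) ≡ c (s (suc (toℕ a)))
    h-succ a = trans (cong (c ∘ s) (toℕ-succ a)) (c-next a)

    E-s : ∀ a → E (c (s a)) (c (s (suc a)))
    E-s a with E? (c (s a)) (c (2 + s a))
    ... | yes e = e
    ... | no _ = consec (s a)

    arc⇒E : ∀ x y → Arc t k ρ x y → E (h x) (h y)
    arc⇒E (inj₁ a) (inj₁ b) eq = subst (E _) (trans (sym (c-next a)) (cong (c ∘ s) eq)) (E-s (toℕ a))
    arc⇒E (inj₂ j) (inj₁ b) (inj₁ refl) = E-sym (consec _)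
    arc⇒E (inj₂ j) (inj₁ b) (inj₂ eq) =
      subst (E _) (trans (cong c (sym (s-ear {toℕ (ρ j)} (ρ-ear j)))) (trans (sym (c-next (ρ j))) (cong (c ∘ s) eq))) (consec _)

    -- From an inner vertex, one step leads to the tip of its ear or, without an ear, to the next
    -- inner vertex; an edge over two steps is itself an ear. From a tip, one step leads to the next
    -- inner vertex.
    near⇒arc : ∀ x y → E (h x) (h y) → Near P c (h x) (h y) → Arc t k ρ x y ⊎ Arc t k ρ y x
    near⇒arc x y e (i , i<N , eq , d) with injective i<N (pos-< x) eq
    near⇒arc (inj₁ a) y e (_ , _ , _ , inj₁ eq) | refl with E? (c (s (toℕ a))) (c (2 + s (toℕ a)))
    ... | no ¬f = inj₁ (subst (Arc t k ρ (inj₁ a)) (h-injective (trans (h-succ a) (trans (cong c (s-flat {toℕ a} ¬f)) eq))) (sym (toℕ-succ a)))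
    ... | yes f with ear-ρ a f
    ... | j , refl = inj₂ (subst (λ y → Arc t k ρ y (inj₁ (ρ j))) (h-injective {inj₂ j} {y} eq) (inj₁ refl))
    near⇒arc (inj₁ a) y e (_ , _ , _ , inj₂ eq) | refl =
      inj₁ (subst (Arc t k ρ (inj₁ a)) (h-injective (trans (h-succ a) (trans (cong c (s-ear {toℕ a} f)) eq))) (sym (toℕ-succ a)))
      where
      f : Ear (s (toℕ a))
      f = subst (E _) (sym eq) e
    near⇒arc (inj₂ j) y e (_ , _ , _ , inj₁ eq) | refl =
      inj₁ (subst (Arc t k ρ (inj₂ j)) (h-injective (trans (h-succ (ρ j)) (trans (cong c (s-ear {toℕ (ρ j)} (ρ-ear j))) eq))) (inj₂ (sym (toℕ-succ (ρ j)))))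
    -- An edge over two steps from a tip would cross the chord of its ear; the four indices are
    -- distinct modulo the length because of `4≤N`.
    near⇒arc (inj₂ j) y e (_ , _ , _ , inj₂ eq) | refl =
      ⊥-elim (noCrossing free H (n<1+n _) (n<1+n _) (n<1+n _)
        (subst (_< s (toℕ (ρ j)) + suc P) (ℕₚ.+-comm (s (toℕ (ρ j))) 3) (ℕₚ.+-monoʳ-< (s (toℕ (ρ j))) 4≤N))
        (ρ-ear j) (subst (E _) (sym eq) e))

    E⇒arc : ∀ x y → E (h x) (h y) → Arc t k ρ x y ⊎ Arc t k ρ y x
    E⇒arc x y e with short e
    ... | inj₁ near = near⇒arc x y e near
    ... | inj₂ near = [ inj₂ , inj₁ ]′ (near⇒arc y x (E-sym e) near)

    G≅Sg : G ≅ Sg t k ρ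
    G≅Sg = ≅-from (Sg t k ρ) (h ∘ splitAt t) inj surj λ u v → ⇔→≡ (mk⇔ (edge⁺ u v) (edge⁻ u v))
      where
      inj : ∀ {u v} → h (splitAt t u) ≡ h (splitAt t v) → u ≡ v
      inj {u} {v} eq = trans (sym (Finₚ.join-splitAt t k u)) (trans (cong (join t k) (h-injective {splitAt t u} {splitAt t v} eq)) (Finₚ.join-splitAt t k v))
      surj : ∀ v → ∃ λ u → h (splitAt t u) ≡ v
      surj v with h-surjective v
      ... | x , eq = join t k x , trans (cong h (Finₚ.splitAt-join t k x)) eq
      edge⁺ : ∀ u v → E (h (splitAt t u)) (h (splitAt t v)) → adj (Sg t k ρ) u v ≡ true
      edge⁺ u v e = from (closeAdj-⇔ (rawS t k ρ)) ((λ { refl → E-irrefl e refl }) ,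
        [ inj₁ ∘ from (rawS-⇔ t k ρ u v) , inj₂ ∘ from (rawS-⇔ t k ρ v u) ]′ (E⇒arc (splitAt t u) (splitAt t v) e))
      edge⁻ : ∀ u v → adj (Sg t k ρ) u v ≡ true → E (h (splitAt t u)) (h (splitAt t v))
      edge⁻ u v eq = [ arc⇒E (splitAt t u) (splitAt t v) ∘ to (rawS-⇔ t k ρ u v) ,
                       E-sym ∘ arc⇒E (splitAt t v) (splitAt t u) ∘ to (rawS-⇔ t k ρ v u) ]′
                     (proj₂ (to (closeAdj-⇔ (rawS t k ρ)) eq))

  -- The classification

  InS : Set
  InS = Σ ℕ λ t → 3 ≤ t × Σ ℕ λ k → Σ (Fin k → Fin t) λ ρ → Injective _≡_ _≡_ ρ × (G ≅ Sg t k ρ)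

  InZ : Set
  InZ = Σ ℕ λ d → 1 ≤ d × ((G ≅ Zg d) ⊎ (G ≅ Zstar d))

  module Classification (claw : ClawFree) (free : MinorFree G K4) where

    -- Without an ear over `c 0` the inner cycle can start there and closes up at `s t ≡ suc P`; the
    -- bound on `s 2` then forces `t` to be at least 3.
    short⇒S : ∀ {P c} → Ham P c → ¬ E (c P) (c (2 + P)) → 4 ≤ suc P → Sequence.s c 2 < suc P →
      Short P c → InS
    short⇒S {P} {c} H ¬seam 4≤N s2<N short with Sequence.closes c ¬seam
    ... | t , s-t = t , s-cancel-< {2} {t} (subst (s 2 <_) (sym s-t) s2<N) , k , ρ , ρ-injective , G≅Sg
      where
      open Sequence c using (s; s-cancel-<)
      open InnerCycle free H 4≤N short t s-t

    module _ {m : ℕ} where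
      open Zigzag claw free {m}

      -- One side has 3 + q cycle edges; the bound says that the other, with m - 1 - q, also has at
      -- least three.
      LongChord : (ℕ → V) → ℕ → ℕ → Set
      LongChord c r q = 4 + q ≤ m × E (c r) (c (r + (3 + q)))

      longChord? : ∀ c → Dec (∃ λ r → r < 2 + m × ∃ λ q → q < m × LongChord c r q)
      longChord? c = ℕₚ.anyUpTo? (λ r → ℕₚ.anyUpTo? (λ q → (4 + q ≤? m) ×-dec E? _ _) m) (2 + m)

      -- Distinguishes the number of steps from the smaller index to the larger: one or two are
      -- short already, `m` or `suc m` leave two or one on the other side, and all values between
      -- give a long chord.
      noLongChord⇒short : ∀ {c} → Ham (suc m) c →
        (∀ {r q} → r < 2 + m → ¬ LongChord c r q) → Short (suc m) c
      noLongChord⇒short {c} H none {u} {v} e = go (surjective u) (surjective v) e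
        where
        open Ham H
        near : ∀ {i j} → i < j → j < 2 + m → E (c i) (c j) → Near (suc m) c (c i) (c j) ⊎ Near (suc m) c (c j) (c i)
        near {i} i<j j<N e with ℕₚ.m≤n⇒∃[o]m+o≡n i<j
        ... | 0 , refl = inj₁ (i , ℕₚ.<-trans i<j j<N , refl , inj₁ (cong c (sym (ℕₚ.+-identityʳ _))))
        ... | 1 , refl = inj₁ (i , ℕₚ.<-trans i<j j<N , refl , inj₂ (cong (c ∘ suc) (ℕₚ.+-comm 1 i)))
        ... | suc (suc q) , refl with <-cmp (3 + q) m
        ...   | tri< l _ _ = ⊥-elim (none (ℕₚ.<-trans i<j j<N) (l , subst (E (c i)) (cong c (sym (ℕₚ.+-suc i (2 + q)))) e))
        ...   | tri≈ _ refl _ = inj₂ (_ , j<N , refl , inj₂ (trans (cong c (lem i q)) (period i)))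
          where
          lem : ∀ i q → 2 + (suc i + suc (suc q)) ≡ i + (2 + (3 + q))
          lem = solve-∀
        ...   | tri> _ _ l = inj₂ (_ , j<N , refl , inj₁ (trans (cong c (trans (lem i q) (cong (λ x → i + suc x) 3+q≡1+m))) (period i)))
          where
          lem : ∀ i q → suc (suc i + suc (suc q)) ≡ i + suc (3 + q)
          lem = solve-∀
          3+q≡1+m : 3 + q ≡ suc m
          3+q≡1+m = ℕₚ.≤-antisym (≤-trans (ℕₚ.m≤n+m (3 + q) i) (subst (_≤ suc m) (sym (ℕₚ.+-suc i (2 + q))) (ℕₚ.≤-pred j<N))) l
        go : ∀ {u v} → (∃ λ i → i < 2 + m × c i ≡ u) → (∃ λ j → j < 2 + m × c j ≡ v) → E u v → Near (suc m) c u v ⊎ Near (suc m) c v u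
        go (i , i<N , refl) (j , j<N , refl) e with <-cmp i j
        ... | tri< i<j _ _ = near i<j j<N e
        ... | tri≈ _ refl _ = ⊥-elim (E-irrefl e refl)
        ... | tri> _ _ j<i = [ inj₂ , inj₁ ]′ (near j<i i<N (E-sym e))

      earPair⇒Z : ∀ {c} → Ham (suc m) c → EarPair c → InZ
      earPair⇒Z H ear = zig⇒Z H (earPair⇒zig H ear)

      longChord⇒Z : ∀ {c r q} → Ham (suc m) c → LongChord c r q → InZ
      longChord⇒Z {c} {r} {q} H (l , e) with longChord⇒earPair q (rotate H r) l (subst (λ x → E (c x) (c (r + (3 + q)))) (sym (ℕₚ.+-identityʳ r)) e)
      ... | _ , H′ , ear = earPair⇒Z H′ ear

      classify-seamless : ∀ {c} → Ham (suc m) c → ¬ E (c (suc m)) (c (3 + m)) →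
        2 ≤ m → Sequence.s c 2 < 2 + m → InZ ⊎ InS
      classify-seamless {c} H ¬seam 2≤m s2<N with longChord? c
      ... | yes (r , _ , q , _ , l) = inj₁ (longChord⇒Z H l)
      ... | no none = inj₂ (short⇒S H ¬seam (s≤s (s≤s 2≤m)) s2<N
              (noLongChord⇒short H λ {r} {q} r<N l → none (r , r<N , q , ≤-trans (ℕₚ.m≤n+m (suc q) 3) (proj₁ l) , l)))

    -- The general bound `s 2 ≤ 4` secures three inner vertices only from length five on, so lengths
    -- three and four are treated apart.
    classify : ∀ m {c} → 1 ≤ m → Ham (suc m) c → InZ ⊎ InS
    classify 1 _ H = inj₁ (Zigzag.zig⇒Z claw free H (triangle-zig claw free H))
    -- In length four a diagonal makes an ear pair, since the second edge of the pair lies on the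
    -- cycle.
    classify 2 {c} _ H with E? (c 0) (c 2) | E? (c 1) (c 3)
    ... | yes e | _ = inj₁ (earPair⇒Z H (e , Ham.consec H 1))
    ... | no _ | yes e = inj₁ (earPair⇒Z (rotate₁ H) (e , Ham.consec H 2))
    -- Without diagonals the inner cycle skips nothing, hence `s 2 ≡ 2`.
    ... | no ¬e | no ¬f = classify-seamless H (λ f → ¬f (E-sym (subst (E (c 3)) (Ham.period H 1) f))) ≤-refl
      (subst (_< 4) (sym s2≡2) (s≤s (s≤s (s≤s z≤n))))
      where
      open Sequence c
      s1≡1 : s 1 ≡ 1
      s1≡1 = s-flat {0} ¬e
      s2≡2 : s 2 ≡ 2
      s2≡2 = trans (s-flat {1} (λ f → ¬f (subst Ear s1≡1 f))) (cong suc s1≡1)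
    classify m@(suc (suc (suc m′))) {c} _ H with E? (c (suc m)) (c (3 + m))
    ... | no ¬seam = classify-seamless H ¬seam (s≤s (s≤s z≤n)) (≤-trans (s≤s (Sequence.s-double c 2)) (s≤s (s≤s (s≤s (s≤s (s≤s z≤n))))))
    -- `c 0` is the tip of an ear, so the numbering starts at `c 1` instead. An ear over `c 1` as
    -- well would cross the first one.
    ... | yes seam = classify-seamless (rotate₁ H) ¬seam′ (s≤s (s≤s z≤n)) (≤-trans (s≤s (Sequence.s-double (c ∘ suc) 2)) (s≤s (s≤s (s≤s (s≤s (s≤s z≤n))))))
      where
      open Ham H
      ¬seam′ : ¬ E (c (2 + m)) (c (4 + m))
      ¬seam′ f = noCrossing₀ free H z<s (n<1+n 1) (s≤s (s≤s (s≤s z≤n))) (n<1+n _)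
        (subst₂ E (period 0) (period 2) f) (E-sym (subst (E (c (suc m))) (period 1) seam))

theorem4p1 : (G : Graph) → TwoConnected G → Free G K13 → MinorFree G K4 →
    Outerplanar G ×
    ((Σ ℕ λ d → 1 ≤ d × ((G ≅ Zg d) ⊎ (G ≅ Zstar d))) ⊎
    (Σ ℕ λ t → 3 ≤ t × Σ ℕ λ k → Σ (Fin k → Fin t) λ ρ →
    Injective _≡_ _≡_ ρ × (G ≅ Sg t k ρ)))
theorem4p1 G two clawfree free with InGraph.hamiltonian G two (InGraph.clawFree G clawfree) free
... | u , xs , C , all with InGraph.toHam G C all
... | c , H = outerplanar free H , classified (length xs) H 3≤N
  where
  open InGraph G
  3≤N : 3 ≤ suc (length xs)
  -- Every vertex has its own index on the cycle, so the cycle is at least as long as `n G`.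
  3≤N = ≤-trans (proj₁ two) (injective⇒≤ {f = index ∘ all} λ {v} {w} eq →
          trans (lookup-index (all v)) (trans (cong (lookup (u ∷ xs)) eq) (sym (lookup-index (all w)))))
  classified : ∀ P {c} → Ham P c → 3 ≤ suc P → InZ ⊎ InS
  classified (suc m) H (s≤s 2≤) = Classification.classify (clawFree clawfree) free m (ℕₚ.≤-pred 2≤) H
  classified zero H (s≤s ())
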